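{- Let $\kappa\ge\Delta\ge 2$. For every fixed (oblivious) update sequence on a general (unrooted) forest of maximum degree at most $\Delta$ starting from the empty forest, and every $t\ge 0$, the random coloring maintained by {\textsc{DistMaint}} after $t$ updates is distributed uniformly over all proper edge colorings of the current forest with colors $[\kappa]$.
   Context: Updates are insertions of edges joining two distinct trees and deletions of edges; maximum degree stays at most $\Delta$. $A(x)$ = colors of $[\kappa]$ not used on edges at $x$. {\textsc{DistMaint}} keeps a designated root in every tree (initially each vertex is a root; rerooting changes only designation, not colors). FixForbidden$(v,\alpha,\beta)$: if no child edge of $v$ has color $\beta$ stop; else recolor that child edge $(v,w)$ to $\alpha$ and call FixForbidden$(w,\beta,\alpha)$. Insertion of $(u,v)$ with trees $T_u,T_v$: if both have at most $\Delta$ edges name endpoints so $\deg(v)\le\deg(u)$, else so $|E(T_v)|\le|E(T_u)|$; reroot $T_v$ at $v$, make $v$ a child of $u$, choose $\beta$ uniformly from $A(u)$ and color $(u,v)$ by $\beta$; if no child edge of $v$ has color $\beta$ stop, else for that edge $(v,w)$ choose $\alpha$ uniformly from $A(v)$, recolor $(v,w)$ to $\alpha$ and call FixForbidden$(w,\beta,\alpha)$. Deletion of $(u,v)$ where (in the current rooting) $u$ is the parent of $v$ and the color is $\alpha$: delete it; with $\ell$ the number of children of $v$, with probability $(\kappa-\ell)/\kappa$ stop; otherwise pick a uniformly random child $w$ of $v$, let $\beta=\mathrm{color}(v,w)$, recolor $(v,w)$ to $\alpha$ and call FixForbidden$(w,\beta,\alpha)$. Random choices are independent. -}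

module Defs where

open import Data.Nat as ℕ using (ℕ; zero; suc; _∸_; _≤ᵇ_; _<ᵇ_; _<_)
open import Data.Fin as F using (Fin; toℕ)
open import Data.Bool using (Bool; true; false; if_then_else_; _∧_; _∨_; not)
open import Data.Maybe using (Maybe; just; nothing; is-just)
open import Data.List using (List; []; _∷_; filterᵇ; length; head; allFin; lookup)
open import Data.Bool.ListAction using (all; any)
open import Data.Product using (_×_; _,_; proj₂)
open import Data.Integer using (+_)
open import Data.Rational using (ℚ; 0ℚ; 1ℚ; _/_) renaming (_+_ to _+ℚ_; _*_ to _*ℚ_)
open import Relation.Nullary using (¬_; ⌊_⌋)
open import Relation.Binary.PropositionalEquality using (_≡_; _≢_)

-- A randomized computation: either returns, or draws i uniformly from Fin k.
data Rand (A : Set) : Set where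
  ret    : A → Rand A
  choose : (k : ℕ) → (Fin k → Rand A) → Rand A

_>>=_ : {A B : Set} → Rand A → (A → Rand B) → Rand B
ret a      >>= g = g a
choose k f >>= g = choose k (λ i → f i >>= g)

uniformL : {A B : Set} → (xs : List B) → (B → Rand A) → Rand A
uniformL xs f = choose (length xs) (λ i → f (lookup xs i))

sumFin : (k : ℕ) → (Fin k → ℚ) → ℚ
sumFin zero    g = 0ℚ
sumFin (suc k) g = g F.zero +ℚ sumFin k (λ i → g (F.suc i))

Pr : {A : Set} → Rand A → (A → Bool) → ℚ
Pr (ret a)             P = if P a then 1ℚ else 0ℚ
Pr (choose zero f)     P = 0ℚ
Pr (choose (suc k) f)  P = sumFin (suc k) (λ i → Pr (f i) P) *ℚ (+ 1 / suc k)

-- Ground truth: the (unrooted) forest on vertex set Fin n as a symmetric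
-- adjacency matrix, and the update sequences.

Adj : ℕ → Set
Adj n = Fin n → Fin n → Bool

_==_ : {n : ℕ} → Fin n → Fin n → Bool
x == y = ⌊ x F.≟ y ⌋

emptyF : {n : ℕ} → Adj n
emptyF _ _ = false

data Update (n : ℕ) : Set where
  ins : Fin n → Fin n → Update n
  del : Fin n → Fin n → Update n

setEdge : {n : ℕ} → Adj n → Fin n → Fin n → Bool → Adj n
setEdge G u v b x y =
  if (x == u ∧ y == v) ∨ (x == v ∧ y == u) then b else G x y

applyF : {n : ℕ} → Adj n → Update n → Adj n
applyF G (ins u v) = setEdge G u v true
applyF G (del u v) = setEdge G u v false

forestAfter : {n : ℕ} → List (Update n) → Adj n
forestAfter us = go emptyF us
  where
  go : _ → _ → _
  go G []       = G
  go G (u ∷ us) = go (applyF G u) us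

degF : {n : ℕ} → Adj n → Fin n → ℕ
degF {n} G x = length (filterᵇ (G x) (allFin n))

data Conn {n : ℕ} (G : Adj n) : Fin n → Fin n → Set where
  here : ∀ {x} → Conn G x x
  step : ∀ {x y z} → G x y ≡ true → Conn G y z → Conn G x z

ValidUpd : {n : ℕ} → ℕ → Adj n → Update n → Set
ValidUpd Δ G (ins u v) = u ≢ v × ¬ Conn G u v × degF G u < Δ × degF G v < Δ
ValidUpd Δ G (del u v) = G u v ≡ true

data ⊤' : Set where
  tt' : ⊤'

ValidSeq : {n : ℕ} → ℕ → Adj n → List (Update n) → Set
ValidSeq Δ G []       = ⊤'
ValidSeq Δ G (u ∷ us) = ValidUpd Δ G u × ValidSeq Δ (applyF G u) us

ProperColoring : {n κ : ℕ} → Adj n → (Fin n → Fin n → Fin κ) → Set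
ProperColoring G c =
  (∀ x y → G x y ≡ true → c x y ≡ c y x) ×
  (∀ x y z → G x y ≡ true → G x z ≡ true → y ≢ z → c x y ≢ c x z)

-- State of DistMaint: rooted forest with colours.  par x = just (p , a)
-- means p is the parent of x and the edge (x,p) has colour a;
-- par x = nothing means x is a designated root.

record St (n κ : ℕ) : Set where
  field par : Fin n → Maybe (Fin n × Fin κ)
open St

module Alg {n κ Δ : ℕ} where

  fuel : ℕ
  fuel = suc n

  initSt : St n κ
  initSt = record { par = λ _ → nothing }

  eqMF : {m : ℕ} → Maybe (Fin m) → Maybe (Fin m) → Bool
  eqMF (just a) (just b) = a == b
  eqMF nothing  nothing  = true
  eqMF _        _        = false

  isPar : St n κ → Fin n → Fin n → Bool
  isPar s x y with par s x
  ... | just (p , _) = p == y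
  ... | nothing      = false

  colOf : St n κ → Fin n → Maybe (Fin κ)
  colOf s x with par s x
  ... | just (_ , a) = just a
  ... | nothing      = nothing

  setPar : St n κ → Fin n → Maybe (Fin n × Fin κ) → St n κ
  setPar s x m = record { par = λ y → if y == x then m else par s y }

  recolor : St n κ → Fin n → Fin κ → St n κ
  recolor s x a with par s x
  ... | just (p , _) = setPar s x (just (p , a))
  ... | nothing      = s

  children : St n κ → Fin n → List (Fin n)
  children s v = filterᵇ (λ x → isPar s x v) (allFin n)

  childWithColor : St n κ → Fin n → Fin κ → Maybe (Fin n)
  childWithColor s v b = head (filterᵇ (λ x → isPar s x v ∧ eqMF (colOf s x) (just b)) (allFin n))

  deg : St n κ → Fin n → ℕ
  deg s x = length (children s x) ℕ.+ (if is-just (par s x) then 1 else 0)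

  used : St n κ → Fin n → Fin κ → Bool
  used s x a = any (λ y → isPar s y x ∧ eqMF (colOf s y) (just a)) (allFin n)
               ∨ eqMF (colOf s x) (just a)

  avail : St n κ → Fin n → List (Fin κ)
  avail s x = filterᵇ (λ a → not (used s x a)) (allFin κ)

  rootF : ℕ → St n κ → Fin n → Fin n
  rootF zero    s x = x
  rootF (suc f) s x with par s x
  ... | just (p , _) = rootF f s p
  ... | nothing      = x

  root : St n κ → Fin n → Fin n
  root = rootF fuel

  treeEdges : St n κ → Fin n → ℕ
  treeEdges s x = length (filterᵇ (λ y → root s y == root s x) (allFin n)) ∸ 1

  rerootAttach : ℕ → St n κ → Fin n → Maybe (Fin n × Fin κ) → St n κ
  rerootAttach zero    s v new = setPar s v new
  rerootAttach (suc f) s v new with par s v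
  ... | nothing      = setPar s v new
  ... | just (p , c) = rerootAttach f (setPar s v new) p (just (v , c))

  fixForbidden : ℕ → St n κ → Fin n → Fin κ → Fin κ → St n κ
  fixForbidden zero    s v α β = s
  fixForbidden (suc f) s v α β with childWithColor s v β
  ... | nothing = s
  ... | just w  = fixForbidden f (recolor s w α) w β α

  -- naming of endpoints (ties keep the given order)
  name : St n κ → Fin n → Fin n → Fin n × Fin n
  name s u v =
    if (treeEdges s u ℕ.≤ᵇ Δ) ∧ (treeEdges s v ℕ.≤ᵇ Δ)
    then (if deg s v ℕ.≤ᵇ deg s u then (u , v) else (v , u))
    else (if treeEdges s v ℕ.≤ᵇ treeEdges s u then (u , v) else (v , u))

  insertNamed : St n κ → Fin n → Fin n → Rand (St n κ)
  insertNamed s u v =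
    uniformL (avail s u) λ β →
      let s1 = rerootAttach fuel s v (just (u , β)) in
      cont s1 β (childWithColor s1 v β)
    where
    cont : St n κ → Fin κ → Maybe (Fin n) → Rand (St n κ)
    cont s1 β nothing  = ret s1
    cont s1 β (just w) =
      uniformL (avail s1 v) λ α → ret (fixForbidden fuel (recolor s1 w α) w β α)

  insert : St n κ → Fin n → Fin n → Rand (St n κ)
  insert s u v with name s u v
  ... | (u' , v') = insertNamed s u' v'

  nth : {A : Set} → List A → ℕ → Maybe A
  nth []       _       = nothing
  nth (x ∷ xs) zero    = just x
  nth (x ∷ xs) (suc i) = nth xs i

  deleteChild : St n κ → Fin n → Rand (St n κ)
  deleteChild s v with par s v
  ... | nothing      = ret s
  ... | just (_ , α) =
        let s1 = setPar s v nothing in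
        choose κ (λ i → pick s1 (nth (children s1 v) (toℕ i)))
    where
    pick2 : St n κ → Fin n → Maybe (Fin κ) → Rand (St n κ)
    pick2 s1 w (just β) = ret (fixForbidden fuel (recolor s1 w α) w β α)
    pick2 s1 w nothing  = ret s1
    pick : St n κ → Maybe (Fin n) → Rand (St n κ)
    pick s1 nothing  = ret s1           -- probability (κ - ℓ)/κ: stop
    pick s1 (just w) = pick2 s1 w (colOf s1 w)

  delete : St n κ → Fin n → Fin n → Rand (St n κ)
  delete s u v = if isPar s v u then deleteChild s v else deleteChild s u

  stepU : St n κ → Update n → Rand (St n κ)
  stepU s (ins u v) = insert s u v
  stepU s (del u v) = delete s u v

  run : St n κ → List (Update n) → Rand (St n κ)
  run s []       = ret s
  run s (u ∷ us) = stepU s u >>= λ s' → run s' us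

  stateCol : St n κ → Fin n → Fin n → Maybe (Fin κ)
  stateCol s x y =
    if isPar s x y then colOf s x else if isPar s y x then colOf s y else nothing

  stateAdj : St n κ → Fin n → Fin n → Bool
  stateAdj s x y = isPar s x y ∨ isPar s y x

  allV : (Fin n → Bool) → Bool
  allV p = all p (allFin n)

  _⇔ᵇ_ : Bool → Bool → Bool
  true  ⇔ᵇ b = b
  false ⇔ᵇ b = not b

  goodB : Adj n → St n κ → Bool
  goodB G s =
    allV (λ x → allV (λ y → G x y ⇔ᵇ stateAdj s x y)) ∧
    allV (λ x → allV (λ y → allV (λ z →
      not (G x y ∧ G x z ∧ not (y == z)) ∨ not (eqMF (stateCol s x y) (stateCol s x z)))))

  agreeB : Adj n → (Fin n → Fin n → Fin κ) → St n κ → Bool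
  agreeB G c s = allV (λ x → allV (λ y → not (G x y) ∨ eqMF (stateCol s x y) (just (c x y))))

distMaint : (n κ Δ : ℕ) → List (Update n) → Rand (St n κ)
distMaint n κ Δ us = Alg.run {n} {κ} {Δ} (Alg.initSt {n} {κ} {Δ}) us

goodState : {n κ : ℕ} → Adj n → St n κ → Bool
goodState {n} {κ} = Alg.goodB {n} {κ} {0}

agreesWith : {n κ : ℕ} → Adj n → (Fin n → Fin n → Fin κ) → St n κ → Bool
agreesWith {n} {κ} = Alg.agreeB {n} {κ} {0}

{-# OPTIONS --safe #-}
-- The rooting of the forest never depends on the colours, so it suffices to follow, for a deterministic
-- rooted forest, the distribution of its edge colouring. FixForbidden exchanges two colours α, β along the
-- Kempe chain hanging from an edge vw; the chain only depends on which edges have a colour in {α, β}, so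
-- exchanging twice is the identity. Let q be a colouring of the forest without uv, with v a root of degree ℓ,
-- and t a colouring with uv of colour β. Insertion leads from q to t with probability
--   1/(κ - deg u) · ([q = t - uv] + 1/(κ - ℓ) · Σ_w [q = t - uv with the chain at vw flipped so that vw has colour β]),
-- the sum ranging over the ℓ children w of v. Averaged over a uniform q this does not depend on t. Deletion
-- leads from t to q with (κ - deg u)(κ - ℓ)/κ times the same probability: it is the reversed chain, and
-- uniformity after a deletion follows because the insertion probabilities out of q add up to 1.
module Submission where

open import Defs
open import Algebra.Bundles using (CommutativeMonoid)
open import Data.Bool using (Bool; true; false; T; if_then_else_; not; _∧_; _∨_)
open import Data.Bool.ListAction using (all; any)
open import Data.Bool.Properties using (∨-comm)
open import Data.Empty using (⊥; ⊥-elim)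
open import Data.Fin using (Fin; toℕ) renaming (zero to fzero; suc to fsuc)
open import Data.Fin.Permutation.Components using (transpose)
import Data.Fin.Properties as Fin
import Data.Integer as ℤ
import Data.Integer.Properties as ℤ
open import Data.List using (List; []; _∷_; length; lookup; filterᵇ; tabulate; allFin; head; foldl; take)
open import Data.Maybe as Maybe using (Maybe; just; nothing; is-just)
import Data.Maybe.Properties as Maybe
open import Data.Nat as ℕ using (ℕ; zero; suc; _≤_)
import Data.Nat.Properties as ℕ
open import Data.Product using (_×_; _,_; proj₁; proj₂; ∃; map₂)
import Data.Product.Properties as Product
open import Data.Rational using (ℚ; 0ℚ; 1ℚ; _/_; _+_; _*_; toℚᵘ)
open import Data.Rational.Properties using (+-0-commutativeMonoid; +-assoc; +-identityˡ; +-identityʳ; *-assoc; *-comm; *-identityˡ; *-identityʳ; *-zeroˡ; *-distribʳ-+; toℚᵘ-injective; toℚᵘ-homo-+; toℚᵘ-homo-*; toℚᵘ-fromℚᵘ)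
open import Data.Rational.Solver using (module +-*-Solver)
import Data.Rational.Unnormalised as ℚᵘ
import Data.Rational.Unnormalised.Properties as ℚᵘ
open import Data.Sum using (_⊎_; inj₁; inj₂; [_,_]′)
open import Function using (case_of_)
open import Level using (0ℓ)
open import Relation.Binary.PropositionalEquality using (_≡_; _≢_; refl; sym; trans; cong; cong₂; subst; module ≡-Reasoning)
open import Relation.Nullary using (Dec; yes; no; ¬_; ⌊_⌋; Reflects; ofʸ; ofⁿ; invert)
open import Relation.Nullary.Decidable using (map′)
open import Relation.Nullary.Reflects using (_×-reflects_; _⊎-reflects_; _→-reflects_; ¬-reflects)

module Sums (M : CommutativeMonoid 0ℓ 0ℓ) where
  open CommutativeMonoid M hiding (setoid)
    renaming (refl to ≈-refl; sym to ≈-sym; trans to ≈-trans; reflexive to ≈-reflexive)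
  import Algebra.Properties.CommutativeMonoid.Sum M as S

  ∑ : ∀ k → (Fin k → Carrier) → Carrier
  ∑ zero    f = ε
  ∑ (suc k) f = f fzero ∙ ∑ k (λ i → f (fsuc i))

  ∑-cong : ∀ k {f g : Fin k → Carrier} → (∀ i → f i ≡ g i) → ∑ k f ≡ ∑ k g
  ∑-cong zero    f≡g = refl
  ∑-cong (suc k) f≡g = cong₂ _∙_ (f≡g fzero) (∑-cong k (λ i → f≡g (fsuc i)))

  ∑≡sum : ∀ k f → ∑ k f ≡ S.sum f
  ∑≡sum zero    f = refl
  ∑≡sum (suc k) f = cong (f fzero ∙_) (∑≡sum k (λ i → f (fsuc i)))

  ∑-zero : ∀ k (f : Fin k → Carrier) → (∀ i → f i ≈ ε) → ∑ k f ≈ ε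
  ∑-zero zero    f f≈0 = ≈-refl
  ∑-zero (suc k) f f≈0 = ≈-trans (∙-cong (f≈0 fzero) (∑-zero k _ (λ i → f≈0 (fsuc i)))) (identityˡ ε)

  ∑-single : ∀ k (f : Fin k → Carrier) i → (∀ j → j ≢ i → f j ≈ ε) → ∑ k f ≈ f i
  ∑-single (suc k) f fzero f≈0 =
    ≈-trans (∙-congˡ (∑-zero k _ (λ j → f≈0 (fsuc j) λ ()))) (identityʳ (f fzero))
  ∑-single (suc k) f (fsuc i) f≈0 =
    ≈-trans (∙-cong (f≈0 fzero λ ()) (∑-single k _ i (λ j j≢i → f≈0 (fsuc j) λ { refl → j≢i refl })))
            (identityˡ (f (fsuc i)))

  ∑-+ : ∀ k (f g : Fin k → Carrier) → ∑ k (λ i → f i ∙ g i) ≈ ∑ k f ∙ ∑ k g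
  ∑-+ k f g = ≈-trans (≈-reflexive (∑≡sum k _))
    (≈-trans (S.∑-distrib-+ f g) (≈-reflexive (sym (cong₂ _∙_ (∑≡sum k f) (∑≡sum k g)))))

  ∑-swap : ∀ k l (f : Fin k → Fin l → Carrier) →
    ∑ k (λ i → ∑ l (f i)) ≈ ∑ l (λ j → ∑ k (λ i → f i j))
  ∑-swap k l f = ≈-trans (≈-reflexive (trans (∑-cong k (λ i → ∑≡sum l (f i))) (∑≡sum k _)))
    (≈-trans (S.∑-comm f) (≈-reflexive (sym (trans (∑-cong l (λ j → ∑≡sum k _)) (∑≡sum l _)))))

  ∑-filter-tabulate : ∀ {A : Set} k (p : A → Bool) (f : Fin k → A) (g : A → Carrier) →
    let xs = filterᵇ p (tabulate f) in
    ∑ (length xs) (λ i → g (lookup xs i)) ≈ ∑ k (λ i → if p (f i) then g (f i) else ε)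
  ∑-filter-tabulate zero    p f g = ≈-refl
  ∑-filter-tabulate (suc k) p f g with p (f fzero)
  ... | true  = ∙-congˡ (∑-filter-tabulate k p (λ i → f (fsuc i)) g)
  ... | false = ≈-trans (∑-filter-tabulate k p (λ i → f (fsuc i)) g) (≈-sym (identityˡ _))

  ∑-filter : ∀ k (p : Fin k → Bool) (g : Fin k → Carrier) →
    let xs = filterᵇ p (allFin k) in
    ∑ (length xs) (λ i → g (lookup xs i)) ≈ ∑ k (λ i → if p i then g i else ε)
  ∑-filter k p = ∑-filter-tabulate k p (λ i → i)

module ΣN = Sums ℕ.+-0-commutativeMonoid
open Sums +-0-commutativeMonoid

-- Iverson brackets

[_] : {P : Set} → Dec P → ℚ
[ P? ] = if ⌊ P? ⌋ then 1ℚ else 0ℚ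

module _ {P : Set} where

  []-true : (P? : Dec P) → P → [ P? ] ≡ 1ℚ
  []-true (yes _) _ = refl
  []-true (no ¬p) p = ⊥-elim (¬p p)

  []-false : (P? : Dec P) → ¬ P → [ P? ] ≡ 0ℚ
  []-false (yes p) ¬p = ⊥-elim (¬p p)
  []-false (no _)  _  = refl

[]-cong : {P Q : Set} (P? : Dec P) (Q? : Dec Q) → (P → Q) → (Q → P) → [ P? ] ≡ [ Q? ]
[]-cong (yes p) Q?      f g = sym ([]-true Q? (f p))
[]-cong (no ¬p) (yes q) f g = ⊥-elim (¬p (g q))
[]-cong (no ¬p) (no _)  f g = refl

-- Rational arithmetic

sumFin≡∑ : ∀ k (g : Fin k → ℚ) → sumFin k g ≡ ∑ k g
sumFin≡∑ zero    g = refl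
sumFin≡∑ (suc k) g = cong (_+_ (g fzero)) (sumFin≡∑ k (λ i → g (fsuc i)))

∑-*ʳ : ∀ k (f : Fin k → ℚ) c → ∑ k f * c ≡ ∑ k (λ i → f i * c)
∑-*ʳ zero    f c = *-zeroˡ c
∑-*ʳ (suc k) f c =
  trans (*-distribʳ-+ c (f fzero) (∑ k (λ i → f (fsuc i)))) (cong (_+_ (f fzero * c)) (∑-*ʳ k (λ i → f (fsuc i)) c))

ι : ℕ → ℚ
ι k = ∑ k (λ _ → 1ℚ)

-- 1 / k, with the junk value 0 at k = 0
inv : ℕ → ℚ
inv zero    = 0ℚ
inv (suc k) = ℤ.+ 1 / suc k

∑-const : ∀ k c → ∑ k (λ _ → c) ≡ ι k * c
∑-const k c = sym (trans (∑-*ʳ k (λ _ → 1ℚ) c) (∑-cong k (λ _ → *-identityˡ c)))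

ι≡/1 : ∀ k → ι k ≡ ℤ.+ k / 1
ι≡/1 zero    = refl
ι≡/1 (suc k) rewrite ι≡/1 k = toℚᵘ-injective (begin
  toℚᵘ (1ℚ + ℤ.+ k / 1)           ≈⟨ toℚᵘ-homo-+ 1ℚ (ℤ.+ k / 1) ⟩
  toℚᵘ 1ℚ ℚᵘ.+ toℚᵘ (ℤ.+ k / 1)   ≈⟨ ℚᵘ.+-congʳ (toℚᵘ 1ℚ) (toℚᵘ-fromℚᵘ (ℚᵘ.mkℚᵘ (ℤ.+ k) 0)) ⟩
  toℚᵘ 1ℚ ℚᵘ.+ ℚᵘ.mkℚᵘ (ℤ.+ k) 0  ≈⟨ ℚᵘ.*≡* (cong (λ z → z ℤ.* ℤ.+ 1) (cong (λ z → ℤ.+ 1 ℤ.+ z) (ℤ.*-identityʳ (ℤ.+ k)))) ⟩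
  ℚᵘ.mkℚᵘ (ℤ.+ suc k) 0           ≈⟨ ℚᵘ.≃-sym (toℚᵘ-fromℚᵘ (ℚᵘ.mkℚᵘ (ℤ.+ suc k) 0)) ⟩
  toℚᵘ (ℤ.+ suc k / 1)            ∎)
  where open import Relation.Binary.Reasoning.Setoid ℚᵘ.≃-setoid

ι*inv : ∀ k .{{_ : ℕ.NonZero k}} → ι k * inv k ≡ 1ℚ
ι*inv (suc k) rewrite ι≡/1 (suc k) = toℚᵘ-injective (begin
  toℚᵘ (ℤ.+ suc k / 1 * (ℤ.+ 1 / suc k))                ≈⟨ toℚᵘ-homo-* (ℤ.+ suc k / 1) (ℤ.+ 1 / suc k) ⟩
  toℚᵘ (ℤ.+ suc k / 1) ℚᵘ.* toℚᵘ (ℤ.+ 1 / suc k)        ≈⟨ ℚᵘ.*-cong (toℚᵘ-fromℚᵘ (ℚᵘ.mkℚᵘ (ℤ.+ suc k) 0)) (toℚᵘ-fromℚᵘ (ℚᵘ.mkℚᵘ (ℤ.+ 1) k)) ⟩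
  ℚᵘ.mkℚᵘ (ℤ.+ suc k) 0 ℚᵘ.* ℚᵘ.mkℚᵘ (ℤ.+ 1) k          ≈⟨ ℚᵘ.*≡* (trans (ℤ.*-identityʳ _) (trans (ℤ.*-identityʳ (ℤ.+ suc k)) (sym (trans (ℤ.*-identityˡ _) (cong ℤ.+_ (ℕ.+-identityʳ (suc k))))))) ⟩
  toℚᵘ 1ℚ                                           ∎)
  where open import Relation.Binary.Reasoning.Setoid ℚᵘ.≃-setoid

-- Expectations

private variable A B : Set

Ex : Rand A → (A → ℚ) → ℚ
Ex (ret a)      f = f a
Ex (choose k g) f = ∑ k (λ i → Ex (g i) f) * inv k

Pr≡Ex : (m : Rand A) (P : A → Bool) → Pr m P ≡ Ex m (λ a → if P a then 1ℚ else 0ℚ)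
Pr≡Ex (ret a)            P = refl
Pr≡Ex (choose zero g)    P = sym (*-zeroˡ 0ℚ)
Pr≡Ex (choose (suc k) g) P =
  cong (_* (ℤ.+ 1 / suc k))
    (trans (sumFin≡∑ (suc k) (λ i → Pr (g i) P)) (∑-cong (suc k) (λ i → Pr≡Ex (g i) P)))

Ex->>= : (m : Rand A) (g : A → Rand B) (f : B → ℚ) → Ex (m >>= g) f ≡ Ex m (λ a → Ex (g a) f)
Ex->>= (ret a)      g f = refl
Ex->>= (choose k h) g f = cong (_* inv k) (∑-cong k (λ i → Ex->>= (h i) g f))

-- Empty choices are excluded because they lose probability mass.
Always : (A → Set) → Rand A → Set
Always Q (ret a)      = Q a
Always Q (choose k g) = ℕ.NonZero k × (∀ i → Always Q (g i))

Always->>= : {Q : A → Set} {Q′ : B → Set} (m : Rand A) (g : A → Rand B) →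
  Always Q m → (∀ {a} → Q a → Always Q′ (g a)) → Always Q′ (m >>= g)
Always->>= (ret a)      g q         h = h q
Always->>= (choose k f) g (k≢0 , q) h = k≢0 , λ i → Always->>= (f i) g (q i) h

Always-map : {Q Q′ : A → Set} (m : Rand A) → (∀ {a} → Q a → Q′ a) → Always Q m → Always Q′ m
Always-map (ret a)      h q         = h q
Always-map (choose k f) h (k≢0 , q) = k≢0 , λ i → Always-map (f i) h (q i)

Ex-cong : {Q : A → Set} (m : Rand A) {f g : A → ℚ} →
  Always Q m → (∀ a → Q a → f a ≡ g a) → Ex m f ≡ Ex m g
Ex-cong (ret a)      q       h = h a q
Ex-cong (choose k m) (_ , q) h = cong (_* inv k) (∑-cong k (λ i → Ex-cong (m i) (q i) h))

Ex-≗ : (m : Rand A) {f g : A → ℚ} → (∀ a → f a ≡ g a) → Ex m f ≡ Ex m g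
Ex-≗ (ret a)      h = h a
Ex-≗ (choose k g) h = cong (_* inv k) (∑-cong k (λ i → Ex-≗ (g i) h))

Ex-const : ∀ {Q : A → Set} (m : Rand A) c → Always Q m → Ex m (λ _ → c) ≡ c
Ex-const (ret a)      c q = refl
Ex-const (choose k g) c (k≢0 , q) = begin
  ∑ k (λ i → Ex (g i) (λ _ → c)) * inv k ≡⟨ cong (_* inv k) (∑-cong k (λ i → Ex-const (g i) c (q i))) ⟩
  ∑ k (λ _ → c) * inv k                  ≡⟨ cong (_* inv k) (trans (∑-const k c) (*-comm (ι k) c)) ⟩
  c * ι k * inv k                        ≡⟨ *-assoc c (ι k) (inv k) ⟩
  c * (ι k * inv k)                      ≡⟨ cong (c *_) (ι*inv k {{k≢0}}) ⟩
  c * 1ℚ                                 ≡⟨ *-identityʳ c ⟩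
  c                                      ∎
  where open ≡-Reasoning

*-swapʳ : ∀ x y z → x * y * z ≡ x * z * y
*-swapʳ x y z = trans (*-assoc x y z) (trans (cong (x *_) (*-comm y z)) (sym (*-assoc x z y)))

Ex-*ʳ : ∀ (m : Rand A) (f : A → ℚ) c → Ex m (λ a → f a * c) ≡ Ex m f * c
Ex-*ʳ (ret a)      f c = refl
Ex-*ʳ (choose k g) f c = begin
  ∑ k (λ i → Ex (g i) (λ a → f a * c)) * inv k ≡⟨ cong (_* inv k) (∑-cong k (λ i → Ex-*ʳ (g i) f c)) ⟩
  ∑ k (λ i → Ex (g i) f * c) * inv k           ≡⟨ cong (_* inv k) (sym (∑-*ʳ k (λ i → Ex (g i) f) c)) ⟩
  ∑ k (λ i → Ex (g i) f) * c * inv k           ≡⟨ *-swapʳ (∑ k (λ i → Ex (g i) f)) c (inv k) ⟩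
  ∑ k (λ i → Ex (g i) f) * inv k * c           ∎
  where open ≡-Reasoning

Ex-+ : (m : Rand A) (f g : A → ℚ) → Ex m (λ a → f a + g a) ≡ Ex m f + Ex m g
Ex-+ (ret a)      f g = refl
Ex-+ (choose k h) f g =
  trans (cong (_* inv k) (trans (∑-cong k (λ i → Ex-+ (h i) f g)) (∑-+ k (λ i → Ex (h i) f) (λ i → Ex (h i) g))))
        (*-distribʳ-+ (inv k) (∑ k (λ i → Ex (h i) f)) (∑ k (λ i → Ex (h i) g)))

Ex-∑ : ∀ k (m : Rand A) (f : Fin k → A → ℚ) → Ex m (λ a → ∑ k (λ i → f i a)) ≡ ∑ k (λ i → Ex m (f i))
Ex-∑ k (ret a)      f = refl
Ex-∑ k (choose l g) f =
  trans (cong (_* inv l) (trans (∑-cong l (λ j → Ex-∑ k (g j) f)) (∑-swap l k (λ j i → Ex (g j) (f i)))))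
        (∑-*ʳ k (λ i → ∑ l (λ j → Ex (g j) (f i))) (inv l))

Ex-swap : (m : Rand A) (m′ : Rand B) (f : A → B → ℚ) →
  Ex m (λ a → Ex m′ (f a)) ≡ Ex m′ (λ b → Ex m (λ a → f a b))
Ex-swap (ret a)      m′ f = refl
Ex-swap (choose k g) m′ f =
  trans (cong (_* inv k) (trans (∑-cong k (λ i → Ex-swap (g i) m′ f)) (sym (Ex-∑ k m′ (λ i b → Ex (g i) (λ a → f a b))))))
        (sym (Ex-*ʳ m′ (λ b → ∑ k (λ i → Ex (g i) (λ a → f a b))) (inv k)))

Pr-always : (m : Rand A) (P : A → Bool) → Always (λ a → P a ≡ true) m → Pr m P ≡ 1ℚ
Pr-always m P q =
  trans (Pr≡Ex m P)
    (trans (Ex-cong m q (λ a Pa → cong (λ b → if b then 1ℚ else 0ℚ) Pa)) (Ex-const m 1ℚ q))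

∑-nth : ∀ {n κ Δ} k (xs : List A) l → l ℕ.+ length xs ≡ k → (h : Maybe A → ℚ) →
  ∑ k (λ i → h (Alg.nth {n} {κ} {Δ} xs (toℕ i))) ≡ ∑ (length xs) (λ j → h (just (lookup xs j))) + ι l * h nothing
∑-nth k [] l l+0≡k h rewrite sym (trans (sym (ℕ.+-identityʳ l)) l+0≡k) =
  trans (∑-const l (h nothing)) (sym (+-identityˡ (ι l * h nothing)))
∑-nth zero    (x ∷ xs) l eq h with trans (sym (ℕ.+-suc l (length xs))) eq
... | ()
∑-nth {n = n} {κ} {Δ} (suc k) (x ∷ xs) l eq h =
  trans (cong (_+_ (h (just x))) (∑-nth {n = n} {κ} {Δ} k xs l (ℕ.suc-injective (trans (sym (ℕ.+-suc l (length xs))) eq)) h))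
        (sym (+-assoc (h (just x)) (∑ (length xs) (λ j → h (just (lookup xs j)))) (ι l * h nothing)))

size : {A : Set} → Rand A → ℕ
size (ret _)      = 0
size (choose k _) = k

body : {A : Set} (m : Rand A) → Fin (size m) → Rand A
body (choose k f) = f

Ex-body : {A : Set} (m : Rand A) (F : A → ℚ) → ℕ.NonZero (size m) →
  Ex m F ≡ ∑ (size m) (λ i → Ex (body m i) F) * inv (size m)
Ex-body (choose k f) F _ = refl

Always-body : {A : Set} {Q : A → Set} (m : Rand A) → ℕ.NonZero (size m) →
  (∀ i → Always Q (body m i)) → Always Q m
Always-body (choose k f) k≢0 h = k≢0 , h

infix 4 _≋_

record _≋_ {A : Set} (m m′ : Rand A) : Set₁ where
  field
    ≋-Ex     : ∀ F → Ex m F ≡ Ex m′ F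
    ≋-Always : ∀ {Q} → Always Q m → Always Q m′
open _≋_

>>=-assoc : {A B C : Set} (m : Rand A) (f : A → Rand B) (g : B → Rand C) →
  ((m >>= f) >>= g) ≋ (m >>= λ a → f a >>= g)
>>=-assoc m f g = record
  { ≋-Ex = λ F → trans (Ex->>= (m >>= f) g F) (trans (Ex->>= m f _)
      (sym (trans (Ex->>= m (λ a → f a >>= g) F) (Ex-≗ m (λ a → Ex->>= (f a) g F)))))
  ; ≋-Always = always m }
  where
  always : ∀ m {Q} → Always Q ((m >>= f) >>= g) → Always Q (m >>= λ a → f a >>= g)
  always (ret a)      q         = q
  always (choose k h) (k≢0 , q) = k≢0 , λ i → always (h i) (q i)

>>=-cong : {A B : Set} {Q : A → Set} (m : Rand A) (f g : A → Rand B) →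
  Always Q m → (∀ {a} → Q a → f a ≡ g a) → (m >>= f) ≋ (m >>= g)
>>=-cong m f g q f≡g = record
  { ≋-Ex = λ F → trans (Ex->>= m f F) (trans (Ex-cong m q (λ a Qa → cong (λ m → Ex m F) (f≡g Qa))) (sym (Ex->>= m g F)))
  ; ≋-Always = always m q }
  where
  always : ∀ m → Always _ m → ∀ {R} → Always R (m >>= f) → Always R (m >>= g)
  always (ret a)      q       r         = subst (Always _) (f≡g q) r
  always (choose k h) (_ , q) (k≢0 , r) = k≢0 , λ i → always (h i) (q i) (r i)

witness : {A : Set} {Q : A → Set} (m : Rand A) → Always Q m → ∃ Q
witness (ret a)            q       = a , q
witness (choose (suc k) g) (_ , q) = witness (g fzero) (q fzero)

-- Boolean reflection

module _ {P : Set} {b : Bool} where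

  reflects-to : Reflects P b → b ≡ true → P
  reflects-to r refl = invert r

  reflects-from : Reflects P b → P → b ≡ true
  reflects-from (ofʸ _)  _ = refl
  reflects-from (ofⁿ ¬p) p = ⊥-elim (¬p p)

  reflects-false : Reflects P b → ¬ P → b ≡ false
  reflects-false (ofʸ p) ¬p = ⊥-elim (¬p p)
  reflects-false (ofⁿ _) _  = refl

  reflects-¬ : Reflects P b → b ≡ false → ¬ P
  reflects-¬ r refl = invert r

  reflects-map : {Q : Set} → (P → Q) → (Q → P) → Reflects P b → Reflects Q b
  reflects-map f g (ofʸ p)  = ofʸ (f p)
  reflects-map f g (ofⁿ ¬p) = ofⁿ (λ q → ¬p (g q))

reflects-≡ : {P Q : Set} {b c : Bool} → Reflects P b → Reflects Q c → (P → Q) → (Q → P) → b ≡ c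
reflects-≡ (ofʸ p)  rc f g = sym (reflects-from rc (f p))
reflects-≡ (ofⁿ ¬p) rc f g = sym (reflects-false rc (λ q → ¬p (g q)))

any-tabulate-reflects : ∀ {A : Set} {k} {P : Fin k → Set} (p : A → Bool) (f : Fin k → A) →
  (∀ i → Reflects (P i) (p (f i))) → Reflects (∃ P) (any p (tabulate f))
any-tabulate-reflects {k = zero}  p f r = ofⁿ λ ()
any-tabulate-reflects {k = suc k} p f r =
  reflects-map [ (fzero ,_) , (λ (i , q) → fsuc i , q) ]′
               (λ { (fzero , q) → inj₁ q ; (fsuc i , q) → inj₂ (i , q) })
               (r fzero ⊎-reflects any-tabulate-reflects p (λ i → f (fsuc i)) (λ i → r (fsuc i)))

all-tabulate-reflects : ∀ {A : Set} {k} {P : Fin k → Set} (p : A → Bool) (f : Fin k → A) →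
  (∀ i → Reflects (P i) (p (f i))) → Reflects (∀ i → P i) (all p (tabulate f))
all-tabulate-reflects {k = zero}  p f r = ofʸ λ ()
all-tabulate-reflects {k = suc k} p f r =
  reflects-map (λ { (q , qs) fzero → q ; (q , qs) (fsuc i) → qs i })
               (λ q → q fzero , λ i → q (fsuc i))
               (r fzero ×-reflects all-tabulate-reflects p (λ i → f (fsuc i)) (λ i → r (fsuc i)))

head-filter-just : ∀ {A : Set} {k} (p : A → Bool) (f : Fin k → A) {x} →
  head (filterᵇ p (tabulate f)) ≡ just x → p x ≡ true
head-filter-just {k = suc k} p f eq with p (f fzero) in p₀
head-filter-just {k = suc k} p f refl | true = p₀
... | false = head-filter-just p (λ i → f (fsuc i)) eq

head-filter-nothing : ∀ {A : Set} {k} (p : A → Bool) (f : Fin k → A) →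
  head (filterᵇ p (tabulate f)) ≡ nothing → ∀ i → p (f i) ≡ false
head-filter-nothing {k = suc k} p f eq i with p (f fzero) in p₀
head-filter-nothing {k = suc k} p f () i        | true
head-filter-nothing {k = suc k} p f eq fzero    | false = p₀
head-filter-nothing {k = suc k} p f eq (fsuc i) | false = head-filter-nothing p (λ i → f (fsuc i)) eq i

filter-tabulate-cong : ∀ {A : Set} {k} {p q : A → Bool} (f : Fin k → A) →
  (∀ x → p x ≡ q x) → filterᵇ p (tabulate f) ≡ filterᵇ q (tabulate f)
filter-tabulate-cong {k = zero}          f p≡q = refl
filter-tabulate-cong {k = suc k} {p} {q} f p≡q with p (f fzero) | q (f fzero) | p≡q (f fzero)
... | true  | .true  | refl = cong (f fzero ∷_) (filter-tabulate-cong (λ i → f (fsuc i)) p≡q)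
... | false | .false | refl = filter-tabulate-cong (λ i → f (fsuc i)) p≡q

filter-cong : ∀ {k} {p q : Fin k → Bool} → (∀ x → p x ≡ q x) → filterᵇ p (allFin k) ≡ filterᵇ q (allFin k)
filter-cong = filter-tabulate-cong (λ i → i)

lookup-filter : ∀ {A : Set} {k} (p : A → Bool) (f : Fin k → A) i → p (lookup (filterᵇ p (tabulate f)) i) ≡ true
lookup-filter {k = suc k} p f i with p (f fzero) in p₀
lookup-filter {k = suc k} p f fzero    | true = p₀
lookup-filter {k = suc k} p f (fsuc i) | true = lookup-filter p (λ i → f (fsuc i)) i
... | false = lookup-filter p (λ i → f (fsuc i)) i

nth-filter : ∀ {A : Set} {n κ Δ k} (p : A → Bool) (f : Fin k → A) i {x} →
  Alg.nth {n} {κ} {Δ} (filterᵇ p (tabulate f)) i ≡ just x → p x ≡ true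
nth-filter {k = suc k} p f i e with p (f fzero) in p₀
nth-filter {k = suc k} p f zero    refl | true = p₀
nth-filter {n = n} {κ} {Δ} {suc k} p f (suc i) e | true = nth-filter {n = n} {κ} {Δ} p (λ i → f (fsuc i)) i e
nth-filter {n = n} {κ} {Δ} {suc k} p f i e | false = nth-filter {n = n} {κ} {Δ} p (λ i → f (fsuc i)) i e

if-cong : {A : Set} (b : Bool) {x y z : A} → (b ≡ true → x ≡ y) → (if b then x else z) ≡ (if b then y else z)
if-cong true  e = e refl
if-cong false e = refl

if-zero : {A : Set} (b : Bool) {x z : A} → (b ≡ true → x ≡ z) → (if b then x else z) ≡ z
if-zero true  e = e refl
if-zero false e = refl

==-reflects : ∀ {k} (x y : Fin k) → Reflects (x ≡ y) (x == y)
==-reflects x y with x Fin.≟ y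
... | yes p = ofʸ p
... | no ¬p = ofⁿ ¬p

-- Counting

count : ∀ k → (Fin k → Bool) → ℕ
count k p = ΣN.∑ k (λ i → if p i then 1 else 0)

length-filter-tabulate : ∀ {A : Set} k (p : A → Bool) (f : Fin k → A) →
  length (filterᵇ p (tabulate f)) ≡ count k (λ i → p (f i))
length-filter-tabulate zero    p f = refl
length-filter-tabulate (suc k) p f with p (f fzero)
... | true  = cong suc (length-filter-tabulate k p (λ i → f (fsuc i)))
... | false = length-filter-tabulate k p (λ i → f (fsuc i))

length-filter : ∀ k (p : Fin k → Bool) → length (filterᵇ p (allFin k)) ≡ count k p
length-filter k p = length-filter-tabulate k p (λ i → i)

count-mono : ∀ k {p q : Fin k → Bool} → (∀ i → p i ≡ true → q i ≡ true) → count k p ℕ.≤ count k q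
count-mono zero            p⇒q = ℕ.z≤n
count-mono (suc k) {p} {q} p⇒q with p fzero | q fzero | p⇒q fzero | count-mono k (λ i → p⇒q (fsuc i))
... | true  | true  | _ | ih = ℕ.s≤s ih
... | true  | false | h | ih with h refl
...   | ()
count-mono (suc k) p⇒q | false | true  | _ | ih = ℕ.m≤n⇒m≤1+n ih
count-mono (suc k) p⇒q | false | false | _ | ih = ih

count-strict : ∀ k {p q : Fin k → Bool} j → (∀ i → p i ≡ true → q i ≡ true) →
  p j ≡ false → q j ≡ true → count k p ℕ.< count k q
count-strict (suc k) {p} {q} fzero p⇒q pj qj rewrite pj | qj = ℕ.s≤s (count-mono k (λ i → p⇒q (fsuc i)))
count-strict (suc k) {p} {q} (fsuc j) p⇒q pj qj
  with p fzero | q fzero | p⇒q fzero | count-strict k j (λ i → p⇒q (fsuc i)) pj qj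
... | true  | true  | _ | ih = ℕ.s≤s ih
... | true  | false | h | ih with h refl
...   | ()
count-strict (suc k) (fsuc j) p⇒q pj qj | false | true  | _ | ih = ℕ.m≤n⇒m≤1+n ih
count-strict (suc k) (fsuc j) p⇒q pj qj | false | false | _ | ih = ih

count-true : ∀ k → count k (λ _ → true) ≡ k
count-true zero    = refl
count-true (suc k) = cong suc (count-true k)

count-not : ∀ k (p : Fin k → Bool) → count k (λ i → not (p i)) ℕ.+ count k p ≡ k
count-not zero    p = refl
count-not (suc k) p with p fzero
... | true  = trans (ℕ.+-suc _ _) (cong suc (count-not k (λ i → p (fsuc i))))
... | false = cong suc (count-not k (λ i → p (fsuc i)))

just≢nothing : {A : Set} {x : A} → just x ≢ nothing
just≢nothing ()

-- Rooted forests given by their parent function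

Shape : ℕ → Set
Shape n = Fin n → Maybe (Fin n)

module _ {n : ℕ} where

  data Depth (r : Shape n) : Fin n → ℕ → Set where
    isRoot : ∀ {x} → r x ≡ nothing → Depth r x 0
    isChild : ∀ {x p d} → r x ≡ just p → Depth r p d → Depth r x (suc d)

  Acyclic : Shape n → Set
  Acyclic r = ∀ x → ∃ (Depth r x)

  Depth-functional : ∀ {r x d d′} → Depth r x d → Depth r x d′ → d ≡ d′
  Depth-functional (isRoot _)  (isRoot _) = refl
  Depth-functional (isRoot e)  (isChild e′ _) with trans (sym e) e′
  ... | ()
  Depth-functional (isChild e _) (isRoot e′) with trans (sym e) e′
  ... | ()
  Depth-functional (isChild e D) (isChild e′ D′) with trans (sym e) e′
  ... | refl = cong suc (Depth-functional D D′)

  data Below (r : Shape n) (v : Fin n) : Fin n → Set where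
    here : Below r v v
    up   : ∀ {x p} → r x ≡ just p → Below r v p → Below r v x

  module Ranked {r : Shape n} (ac : Acyclic r) where

    depth : Fin n → ℕ
    depth x = proj₁ (ac x)

    depth-< : ∀ {x p} → r x ≡ just p → depth p ℕ.< depth x
    depth-< {x} {p} e = ℕ.≤-reflexive (Depth-functional (isChild e (proj₂ (ac p))) (proj₂ (ac x)))

    depth-≤ : ∀ {v x} → Below r v x → depth v ℕ.≤ depth x
    depth-≤ here     = ℕ.≤-refl
    depth-≤ (up e b) = ℕ.≤-trans (depth-≤ b) (ℕ.<⇒≤ (depth-< e))

    parent-not-below : ∀ {x p} → r x ≡ just p → ¬ Below r x p
    parent-not-below e b = ℕ.<⇒≱ (depth-< e) (depth-≤ b)

    no-loop : ∀ {x} → r x ≢ just x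
    no-loop e = parent-not-below e here

    no-2-cycle : ∀ {x y} → r x ≡ just y → r y ≢ just x
    no-2-cycle e e′ = parent-not-below e (up e′ here)

    -- The depth is less than n too, but this is easier to see after counting the vertices of smaller depth.
    rank : Fin n → ℕ
    rank x = count n (λ y → depth y ℕ.<ᵇ depth x)

    private
      <ᵇ-true : ∀ {k l} → k ℕ.< l → (k ℕ.<ᵇ l) ≡ true
      <ᵇ-true {k} {l} k<l with k ℕ.<ᵇ l | ℕ.<⇒<ᵇ k<l
      ... | true | _ = refl

      <ᵇ-irrefl : ∀ k → (k ℕ.<ᵇ k) ≡ false
      <ᵇ-irrefl zero    = refl
      <ᵇ-irrefl (suc k) = <ᵇ-irrefl k

      true-<ᵇ : ∀ {k l} → (k ℕ.<ᵇ l) ≡ true → k ℕ.< l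
      true-<ᵇ {k} {l} e = ℕ.<ᵇ⇒< k l (subst T (sym e) _)

    rank-< : ∀ {x p} → r x ≡ just p → rank p ℕ.< rank x
    rank-< {x} {p} e = count-strict n p
      (λ i i<p → <ᵇ-true (ℕ.<-trans (true-<ᵇ {depth i} i<p) (depth-< e)))
      (<ᵇ-irrefl (depth p)) (<ᵇ-true (depth-< e))

    rank<n : ∀ x → rank x ℕ.< n
    rank<n x = subst (rank x ℕ.<_) (count-true n)
      (count-strict n x (λ _ _ → refl) (<ᵇ-irrefl (depth x)) refl)

  module _ {r r′ : Shape n} {v : Fin n} (r≡r′ : ∀ {x} → x ≢ v → r′ x ≡ r x) (ac : Acyclic r) where

    Acyclic-detach : r′ v ≡ nothing → Acyclic r′
    Acyclic-detach e x = go (proj₂ (ac x))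
      where
      go : ∀ {x d} → Depth r x d → ∃ (Depth r′ x)
      go {x} D with x Fin.≟ v
      go D           | yes refl = _ , isRoot e
      go (isRoot e′)   | no x≢v   = _ , isRoot (trans (r≡r′ x≢v) e′)
      go (isChild e′ D) | no x≢v  = _ , isChild (trans (r≡r′ x≢v) e′) (proj₂ (go D))

    Acyclic-attach : ∀ {u} → r′ v ≡ just u → ¬ Below r v u → Acyclic r′
    Acyclic-attach {u} e ¬b x = go (proj₂ (ac x))
      where
      away : ∀ {x d} → ¬ Below r v x → Depth r x d → Depth r′ x d
      away ¬b (isRoot e)    = isRoot (trans (r≡r′ λ { refl → ¬b here }) e)
      away ¬b (isChild e D) = isChild (trans (r≡r′ λ { refl → ¬b here }) e) (away (λ b → ¬b (up e b)) D)

      go : ∀ {x d} → Depth r x d → ∃ (Depth r′ x)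
      go {x} D with x Fin.≟ v
      go D            | yes refl = _ , isChild e (away ¬b (proj₂ (ac u)))
      go (isRoot e′)    | no x≢v   = _ , isRoot (trans (r≡r′ x≢v) e′)
      go (isChild e′ D) | no x≢v   = _ , isChild (trans (r≡r′ x≢v) e′) (proj₂ (go D))

-- Coloured rooted forests

module States {n κ : ℕ} where

  open St public using (par)

  infix 4 _≈_ _≈?_ _⊢_

  record _≈_ (s t : St n κ) : Set where
    constructor pointwise
    field at : ∀ x → par s x ≡ par t x
  open _≈_ public

  _≈?_ : (s t : St n κ) → Dec (s ≈ t)
  s ≈? t = map′ pointwise at (Fin.all? (λ x → Maybe.≡-dec (Product.≡-dec Fin._≟_ Fin._≟_) (par s x) (par t x)))

  ≈-sym : ∀ {s t} → s ≈ t → t ≈ s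
  ≈-sym s≈t = pointwise λ x → sym (at s≈t x)

  ≈-trans : ∀ {s t t′} → s ≈ t → t ≈ t′ → s ≈ t′
  ≈-trans s≈t t≈t′ = pointwise λ x → trans (at s≈t x) (at t≈t′ x)

  shape : St n κ → Shape n
  shape s x = Maybe.map proj₁ (par s x)

  record _⊢_ (r : Shape n) (s : St n κ) : Set where
    constructor shaped
    field shape-at : ∀ x → shape s x ≡ r x
  open _⊢_ public

  par⇒shape : ∀ {r s x p a} → r ⊢ s → par s x ≡ just (p , a) → r x ≡ just p
  par⇒shape {x = x} r⊢s e = trans (sym (shape-at r⊢s x)) (cong (Maybe.map proj₁) e)

  shape⇒par : ∀ {r s x p} → r ⊢ s → r x ≡ just p → ∃ λ a → par s x ≡ just (p , a)
  shape⇒par {s = s} {x} r⊢s e with par s x | trans (shape-at r⊢s x) e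
  ... | just (p , a) | refl = a , refl

  shape⇒root : ∀ {r s x} → r ⊢ s → r x ≡ nothing → par s x ≡ nothing
  shape⇒root {s = s} {x} r⊢s e with par s x | trans (shape-at r⊢s x) e
  ... | nothing | refl = refl

  ⊢-resp : ∀ {r s t} → s ≈ t → r ⊢ s → r ⊢ t
  ⊢-resp s≈t r⊢s = shaped λ x → trans (cong (Maybe.map proj₁) (sym (at s≈t x))) (shape-at r⊢s x)

  data Edge (s : St n κ) (x y : Fin n) (a : Fin κ) : Set where
    upward   : par s x ≡ just (y , a) → Edge s x y a
    downward : par s y ≡ just (x , a) → Edge s x y a

  Edge-sym : ∀ {s x y a} → Edge s x y a → Edge s y x a
  Edge-sym (upward e)   = downward e
  Edge-sym (downward e) = upward e

  Edge-resp : ∀ {s t x y a} → s ≈ t → Edge s x y a → Edge t x y a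
  Edge-resp s≈t (upward e)   = upward (trans (sym (at s≈t _)) e)
  Edge-resp s≈t (downward e) = downward (trans (sym (at s≈t _)) e)

  record Proper (s : St n κ) : Set where
    constructor proper
    field unique : ∀ {x y z a} → Edge s x y a → Edge s x z a → y ≡ z
  open Proper public

  Used : St n κ → Fin n → Fin κ → Set
  Used s x a = ∃ λ y → Edge s x y a

  Proper-resp : ∀ {s t} → s ≈ t → Proper s → Proper t
  Proper-resp s≈t prop = proper λ e e′ → unique prop (Edge-resp (≈-sym s≈t) e) (Edge-resp (≈-sym s≈t) e′)

  Used-resp : ∀ {s t x a} → s ≈ t → Used s x a → Used t x a
  Used-resp s≈t (y , e) = y , Edge-resp s≈t e

  Edge-colour : ∀ {r s x y a b} → Acyclic r → r ⊢ s → Edge s x y a → Edge s x y b → a ≡ b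
  Edge-colour ac r⊢s (upward e) (upward e′) with trans (sym e) e′
  ... | refl = refl
  Edge-colour ac r⊢s (downward e) (downward e′) with trans (sym e) e′
  ... | refl = refl
  Edge-colour ac r⊢s (upward e) (downward e′) =
    ⊥-elim (Ranked.no-2-cycle ac (par⇒shape r⊢s e) (par⇒shape r⊢s e′))
  Edge-colour ac r⊢s (downward e) (upward e′) =
    ⊥-elim (Ranked.no-2-cycle ac (par⇒shape r⊢s e) (par⇒shape r⊢s e′))

  record SameEdges (s t : St n κ) : Set where
    field
      edge-to   : ∀ {x y a} → Edge s x y a → Edge t x y a
      edge-from : ∀ {x y a} → Edge t x y a → Edge s x y a
  open SameEdges public

  ≈⇒SameEdges : ∀ {s t} → s ≈ t → SameEdges s t
  ≈⇒SameEdges s≈t = record { edge-to = Edge-resp s≈t ; edge-from = Edge-resp (≈-sym s≈t) }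

  SameEdges-sym : ∀ {s t} → SameEdges s t → SameEdges t s
  SameEdges-sym s∼t = record { edge-to = edge-from s∼t ; edge-from = edge-to s∼t }

  SameEdges-trans : ∀ {s t t′} → SameEdges s t → SameEdges t t′ → SameEdges s t′
  SameEdges-trans s∼t t∼t′ = record
    { edge-to   = λ e → edge-to t∼t′ (edge-to s∼t e)
    ; edge-from = λ e → edge-from s∼t (edge-from t∼t′ e) }

  SameEdges⇒≈ : ∀ {r s t} → Acyclic r → r ⊢ s → r ⊢ t → SameEdges s t → s ≈ t
  SameEdges⇒≈ {r} {s} {t} ac r⊢s r⊢t s∼t = pointwise go
    where
    go : ∀ x → par s x ≡ par t x
    go x with r x in rx
    ... | nothing = trans (shape⇒root r⊢s rx) (sym (shape⇒root r⊢t rx))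
    ... | just p with shape⇒par r⊢s rx
    ...   | a , e with edge-to s∼t (upward e)
    ...     | upward e′   = trans e (sym e′)
    ...     | downward e′ = ⊥-elim (Ranked.no-2-cycle ac rx (par⇒shape r⊢t e′))

  SameEdges⇒Proper : ∀ {s t} → SameEdges s t → Proper s → Proper t
  SameEdges⇒Proper s∼t prop = proper λ e e′ → unique prop (edge-from s∼t e) (edge-from s∼t e′)

count-unique : ∀ k {P : Fin k → Set} {p : Fin k → Bool} {b : Bool} → (∀ i → Reflects (P i) (p i)) →
  (∀ {i j} → P i → P j → i ≡ j) → Reflects (∃ P) b → count k p ≡ (if b then 1 else 0)
count-unique k {p = p} rp uniq (ofʸ (i , Pi)) =
  trans (ΣN.∑-single k _ i (λ j j≢i → cong (λ c → if c then 1 else 0) (reflects-false (rp j) (λ Pj → j≢i (uniq Pj Pi)))))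
        (cong (λ c → if c then 1 else 0) (reflects-from (rp i) Pi))
count-unique k rp uniq (ofⁿ ¬P) =
  ΣN.∑-zero k _ (λ i → cong (λ c → if c then 1 else 0) (reflects-false (rp i) (λ Pi → ¬P (i , Pi))))

module Operations {n κ Δ : ℕ} where

  open States {n} {κ} public
  open Alg {n} {κ} {Δ} public

  setPar-same : ∀ s x m → par (setPar s x m) x ≡ m
  setPar-same s x m rewrite reflects-from (==-reflects x x) refl = refl

  setPar-other : ∀ {s x m y} → y ≢ x → par (setPar s x m) y ≡ par s y
  setPar-other {x = x} {y = y} y≢x rewrite reflects-false (==-reflects y x) y≢x = refl

  recolor-other : ∀ {s x a y} → y ≢ x → par (recolor s x a) y ≡ par s y
  recolor-other {s} {x} y≢x with par s x
  ... | just _  = setPar-other {s = s} y≢x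
  ... | nothing = refl

  recolor-same : ∀ {s x a p b} → par s x ≡ just (p , b) → par (recolor s x a) x ≡ just (p , a)
  recolor-same {s} {x} e with par s x
  recolor-same {s} {x} refl | just _ = setPar-same s x _

  recolor-⊢ : ∀ {r s x a} → r ⊢ s → r ⊢ recolor s x a
  recolor-⊢ {r} {s} {x} {a} r⊢s = shaped go
    where
    go : ∀ y → shape (recolor s x a) y ≡ r y
    go y with y Fin.≟ x
    ... | no y≢x = trans (cong (Maybe.map proj₁) (recolor-other {s} y≢x)) (shape-at r⊢s y)
    ... | yes refl with par s x in e
    ...   | nothing = shape-at r⊢s x
    ...   | just (p , b) = trans (cong (Maybe.map proj₁) (setPar-same s x (just (p , a)))) (sym (par⇒shape r⊢s e))

  eqMF-reflects : ∀ {k} (m m′ : Maybe (Fin k)) → Reflects (m ≡ m′) (eqMF m m′)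
  eqMF-reflects (just a) (just b) = reflects-map (cong just) Maybe.just-injective (==-reflects a b)
  eqMF-reflects (just _) nothing  = ofⁿ λ ()
  eqMF-reflects nothing  (just _) = ofⁿ λ ()
  eqMF-reflects nothing  nothing  = ofʸ refl

  isPar-reflects : ∀ s x y → Reflects (∃ λ a → par s x ≡ just (y , a)) (isPar s x y)
  isPar-reflects s x y with par s x
  ... | just (p , a) = reflects-map (λ { refl → a , refl }) (λ { (_ , refl) → refl }) (==-reflects p y)
  ... | nothing      = ofⁿ λ ()

  colOf-just : ∀ s x {p a} → par s x ≡ just (p , a) → colOf s x ≡ just a
  colOf-just s x e with par s x
  colOf-just s x refl | just _ = refl

  coloured-reflects : ∀ s x v a → Reflects (par s x ≡ just (v , a)) (isPar s x v ∧ eqMF (colOf s x) (just a))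
  coloured-reflects s x v a =
    reflects-map (λ { ((_ , e) , e′) → trans e (cong (λ c → just (v , c)) (Maybe.just-injective (trans (sym (colOf-just s x e)) e′))) })
                 (λ e → (a , e) , colOf-just s x e)
                 (isPar-reflects s x v ×-reflects eqMF-reflects (colOf s x) (just a))

  childWithColor-just : ∀ {s v a w} → childWithColor s v a ≡ just w → par s w ≡ just (v , a)
  childWithColor-just {s} {v} {a} {w} e =
    reflects-to (coloured-reflects s w v a) (head-filter-just _ (λ i → i) e)

  childWithColor-nothing : ∀ {s v a} → childWithColor s v a ≡ nothing → ∀ x → par s x ≢ just (v , a)
  childWithColor-nothing {s} {v} {a} e x =
    reflects-¬ (coloured-reflects s x v a) (head-filter-nothing _ (λ i → i) e x)

  used-reflects : ∀ s x a → Reflects (Used s x a) (used s x a)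
  used-reflects s x a =
    reflects-map
      [ (λ (y , e) → y , downward e) , parent ]′
      (λ { (y , upward e) → inj₂ (colOf-just s x e) ; (y , downward e) → inj₁ (y , e) })
      (any-tabulate-reflects _ (λ i → i) (λ y → coloured-reflects s y x a) ⊎-reflects eqMF-reflects (colOf s x) (just a))
    where
    parent : colOf s x ≡ just a → Used s x a
    parent e with par s x in e′
    parent refl | just (p , _) = p , upward e′

  available-reflects : ∀ s x a → Reflects (¬ Used s x a) (not (used s x a))
  available-reflects s x a = ¬-reflects (used-reflects s x a)

  avail-cong : ∀ {s t x} → (∀ {a} → Used s x a → Used t x a) → (∀ {a} → Used t x a → Used s x a) →
    avail s x ≡ avail t x
  avail-cong {s} {t} {x} f g =
    filter-cong (λ a → cong not (reflects-≡ (used-reflects s x a) (used-reflects t x a) f g))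

  stateAdj-reflects : ∀ s x y → Reflects (∃ (Edge s x y)) (stateAdj s x y)
  stateAdj-reflects s x y =
    reflects-map [ (λ (a , e) → a , upward e) , (λ (a , e) → a , downward e) ]′
                 (λ { (a , upward e) → inj₁ (a , e) ; (a , downward e) → inj₂ (a , e) })
                 (isPar-reflects s x y ⊎-reflects isPar-reflects s y x)

  module _ {r : Shape n} (ac : Acyclic r) {s : St n κ} (r⊢s : r ⊢ s) where

    stateCol-edge : ∀ {x y a} → Edge s x y a → stateCol s x y ≡ just a
    stateCol-edge {x} {y} (upward e)
      rewrite reflects-from (isPar-reflects s x y) (_ , e) = colOf-just s x e
    stateCol-edge {x} {y} (downward e)
      rewrite reflects-false (isPar-reflects s x y)
                (λ (_ , e′) → Ranked.no-2-cycle ac (par⇒shape r⊢s e) (par⇒shape r⊢s e′))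
            | reflects-from (isPar-reflects s y x) (_ , e) = colOf-just s y e

    edge-stateCol : ∀ {x y a} → stateCol s x y ≡ just a → Edge s x y a
    edge-stateCol {x} {y} e with isPar s x y | isPar-reflects s x y
    ... | true | ofʸ (b , e′) with trans (sym (colOf-just s x e′)) e
    ...   | refl = upward e′
    edge-stateCol {x} {y} e | false | _ with isPar s y x | isPar-reflects s y x
    ...   | true | ofʸ (b , e′) with trans (sym (colOf-just s y e′)) e
    ...     | refl = downward e′
    edge-stateCol {x} {y} () | false | _ | false | _

    stateCol-reflects : ∀ x y a → Reflects (Edge s x y a) (eqMF (stateCol s x y) (just a))
    stateCol-reflects x y a =
      reflects-map edge-stateCol stateCol-edge (eqMF-reflects (stateCol s x y) (just a))

    -- Double counting of the coloured edges at x, by colour and by neighbour.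
    length-avail : Proper s → ∀ x → length (avail s x) ℕ.+ length (filterᵇ (stateAdj s x) (allFin n)) ≡ κ
    length-avail prop x = begin
      length (avail s x) ℕ.+ length (filterᵇ (stateAdj s x) (allFin n))
        ≡⟨ cong₂ ℕ._+_ (length-filter κ _) (length-filter n _) ⟩
      count κ (λ a → not (used s x a)) ℕ.+ count n (stateAdj s x)
        ≡⟨ cong (count κ (λ a → not (used s x a)) ℕ.+_) double ⟩
      count κ (λ a → not (used s x a)) ℕ.+ count κ (used s x)
        ≡⟨ count-not κ (used s x) ⟩
      κ ∎
      where
      open ≡-Reasoning
      coloured : Fin n → Fin κ → ℕ
      coloured y a = if eqMF (stateCol s x y) (just a) then 1 else 0
      double : count n (stateAdj s x) ≡ count κ (used s x)
      double = begin
        count n (stateAdj s x)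
          ≡⟨ ΣN.∑-cong n (λ y → sym (count-unique κ (stateCol-reflects x y) (Edge-colour ac r⊢s) (stateAdj-reflects s x y))) ⟩
        ΣN.∑ n (λ y → ΣN.∑ κ (coloured y))
          ≡⟨ ΣN.∑-swap n κ coloured ⟩
        ΣN.∑ κ (λ a → ΣN.∑ n (λ y → coloured y a))
          ≡⟨ ΣN.∑-cong κ (λ a → count-unique n (λ y → stateCol-reflects x y a) (unique prop) (used-reflects s x a)) ⟩
        count κ (used s x) ∎

module Kempe {n κ Δ : ℕ} where

  open Operations {n} {κ} {Δ}

  Below-trans : ∀ {r : Shape n} {v w x} → Below r v w → Below r w x → Below r v x
  Below-trans b here      = b
  Below-trans b (up e b′) = up e (Below-trans b b′)

  -- For σ the transposition of two colours, this is the Kempe chain hanging from w.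
  data Chain (σ : Fin κ → Fin κ) (s : St n κ) (w : Fin n) : Fin n → Set where
    top  : Chain σ s w w
    down : ∀ {x p a} → par s x ≡ just (p , a) → σ a ≢ a → Chain σ s w p → Chain σ s w x

  record Flipped (σ : Fin κ → Fin κ) (w : Fin n) (s t : St n κ) : Set where
    field
      on  : ∀ {x} → Chain σ s w x → par t x ≡ Maybe.map (map₂ σ) (par s x)
      off : ∀ {x} → ¬ Chain σ s w x → par t x ≡ par s x
  open Flipped

  module _ {σ : Fin κ → Fin κ} {r : Shape n} (ac : Acyclic r) {w : Fin n} where

    chain-below : ∀ {s x} → r ⊢ s → Chain σ s w x → Below r w x
    chain-below r⊢s top          = here
    chain-below r⊢s (down e _ c) = up (par⇒shape r⊢s e) (chain-below r⊢s c)

    chain? : ∀ {s} → r ⊢ s → ∀ x → Dec (Chain σ s w x)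
    chain? {s} r⊢s x = go (proj₂ (ac x))
      where
      go : ∀ {x d} → Depth r x d → Dec (Chain σ s w x)
      go {x} D with x Fin.≟ w
      go D | yes refl = yes top
      go (isRoot e) | no x≢w = no λ
        { top → x≢w refl
        ; (down e′ _ _) → just≢nothing (trans (sym (par⇒shape r⊢s e′)) e) }
      go (isChild e D) | no x≢w with shape⇒par r⊢s e
      ... | a , e′ with σ a Fin.≟ a | go D
      ...   | no σa≢a | yes c = yes (down e′ σa≢a c)
      ...   | yes σa≡a | _ = no λ
        { top → x≢w refl
        ; (down e″ σb≢b _) → σb≢b (subst (λ b → σ b ≡ b) (colour-≡ e′ e″) σa≡a) }
        where
        colour-≡ : ∀ {p q a b x} → par s x ≡ just (p , a) → par s x ≡ just (q , b) → a ≡ b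
        colour-≡ e e′ = cong proj₂ (Maybe.just-injective (trans (sym e) e′))
      ...   | no _ | no ¬c = no λ
        { top → x≢w refl
        ; (down e″ _ c) → ¬c (subst (Chain σ s w) (cong proj₁ (Maybe.just-injective (trans (sym e″) e′))) c) }

    Flipped-functional : ∀ {s t t′} → r ⊢ s → Flipped σ w s t → Flipped σ w s t′ → t ≈ t′
    Flipped-functional {s} {t} {t′} r⊢s F F′ = pointwise go
      where
      go : ∀ x → par t x ≡ par t′ x
      go x with chain? r⊢s x
      ... | yes c = trans (on F c) (sym (on F′ c))
      ... | no ¬c = trans (off F ¬c) (sym (off F′ ¬c))

    Flipped-⊢ : ∀ {s t} → r ⊢ s → Flipped σ w s t → r ⊢ t
    Flipped-⊢ {s} {t} r⊢s F = shaped go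
      where
      go : ∀ x → shape t x ≡ r x
      go x with chain? r⊢s x
      ... | no ¬c = trans (cong (Maybe.map proj₁) (off F ¬c)) (shape-at r⊢s x)
      ... | yes c with par s x in e
      ...   | nothing = trans (cong (Maybe.map proj₁) (trans (on F c) (cong (Maybe.map (map₂ σ)) e)))
                              (trans (cong (Maybe.map proj₁) (sym e)) (shape-at r⊢s x))
      ...   | just (p , a) = trans (cong (Maybe.map proj₁) (trans (on F c) (cong (Maybe.map (map₂ σ)) e)))
                                   (trans (cong (Maybe.map proj₁) (sym e)) (shape-at r⊢s x))

    module _ (σσ : ∀ a → σ (σ a) ≡ a) {s t : St n κ} (r⊢s : r ⊢ s) (F : Flipped σ w s t) where

      private
        moved : ∀ {a} → σ a ≢ a → σ (σ a) ≢ σ a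
        moved σa≢a e = σa≢a (trans (sym e) (σσ _))

      chain-to : ∀ {x} → Chain σ s w x → Chain σ t w x
      chain-to top = top
      chain-to c@(down e σa≢a c′) =
        down (trans (on F c) (cong (Maybe.map (map₂ σ)) e)) (moved σa≢a) (chain-to c′)

      chain-from : ∀ {x} → Chain σ t w x → Chain σ s w x
      chain-from top = top
      chain-from {x} (down e σa≢a c) with chain? r⊢s x
      ... | yes c′ = c′
      ... | no ¬c  = down (trans (sym (off F ¬c)) e) σa≢a (chain-from c)

      Flipped-sym : Flipped σ w t s
      on  Flipped-sym {x} c = sym (trans (cong (Maybe.map (map₂ σ)) (on F (chain-from c))) (involutive (par s x)))
        where
        involutive : ∀ m → Maybe.map (map₂ σ) (Maybe.map (map₂ σ) m) ≡ m
        involutive nothing        = refl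
        involutive (just (p , a)) = cong (λ b → just (p , b)) (σσ a)
      off Flipped-sym ¬c = sym (off F (λ c → ¬c (chain-to c)))

      data Origin (x y : Fin n) (a : Fin κ) : Set where
        kept-up      : ¬ Chain σ s w x → par s x ≡ just (y , a)   → Origin x y a
        kept-down    : ¬ Chain σ s w y → par s y ≡ just (x , a)   → Origin x y a
        flipped-up   : Chain σ s w x   → par s x ≡ just (y , σ a) → Origin x y a
        flipped-down : Chain σ s w y   → par s y ≡ just (x , σ a) → Origin x y a

      private
        unflip : ∀ {x p a} → par t x ≡ just (p , a) →
          (¬ Chain σ s w x × par s x ≡ just (p , a)) ⊎ (Chain σ s w x × par s x ≡ just (p , σ a))
        unflip {x} {p} {a} e with chain? r⊢s x
        ... | no ¬c = inj₁ (¬c , trans (sym (off F ¬c)) e)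
        ... | yes c = inj₂ (c , trans (on Flipped-sym (chain-to c)) (cong (Maybe.map (map₂ σ)) e))

      origin : ∀ {x y a} → Edge t x y a → Origin x y a
      origin (upward e) with unflip e
      ... | inj₁ (¬c , e′) = kept-up ¬c e′
      ... | inj₂ (c , e′)  = flipped-up c e′
      origin (downward e) with unflip e
      ... | inj₁ (¬c , e′) = kept-down ¬c e′
      ... | inj₂ (c , e′)  = flipped-down c e′

      module _ {v α β} (w↑v : par s w ≡ just (v , β)) (σβ : σ β ≡ α) (β≢α : β ≢ α)
               (¬used : ¬ Used s v α) (prop : Proper s) where

        private
          σα : σ α ≡ β
          σα = trans (cong σ (sym σβ)) (σσ β)

          chain-moved : ∀ {x p a} → Chain σ s w x → par s x ≡ just (p , σ a) → σ a ≢ a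
          chain-moved top e σa≡a with trans (sym w↑v) e
          ... | refl = β≢α (trans (trans σa≡a (sym (σσ _))) σβ)
          chain-moved (down e′ σb≢b c) e σa≡a with trans (sym e′) e
          ... | refl = σb≢b (cong σ σa≡a)

          ¬chain-v : ¬ Chain σ s w v
          ¬chain-v c = Ranked.parent-not-below ac (par⇒shape r⊢s w↑v) (chain-below r⊢s c)

        new-colour : par t w ≡ just (v , α)
        new-colour = trans (on F top) (trans (cong (Maybe.map (map₂ σ)) w↑v) (cong (λ c → just (v , c)) σβ))

        Flipped-¬Used : ¬ Used t v β
        Flipped-¬Used (y , e) with origin e
        ... | flipped-up c _ = ¬chain-v c
        ... | kept-up _ e′ with unique prop (upward e′) (downward w↑v)
        ...   | refl = Ranked.no-2-cycle ac (par⇒shape r⊢s e′) (par⇒shape r⊢s w↑v)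
        Flipped-¬Used (y , e) | kept-down ¬c e′ with unique prop (downward e′) (downward w↑v)
        ...   | refl = ¬c top
        Flipped-¬Used (y , e) | flipped-down _ e′ =
          ¬used (y , downward (trans e′ (cong (λ c → just (v , c)) σβ)))

        private
          conflict-up : ∀ {x z a} → Chain σ s w x → σ a ≢ a → ¬ (Chain σ s w x) ⊎ (¬ Chain σ s w z × par s z ≡ just (x , a)) → ⊥
          conflict-up c σa≢a (inj₁ ¬c) = ¬c c
          conflict-up c σa≢a (inj₂ (¬c , e)) = ¬c (down e σa≢a c)

          conflict-down : ∀ {x y z a} → Chain σ s w y → par s y ≡ just (x , σ a) → Edge s x z a →
            ¬ (Chain σ s w x) ⊎ (¬ Chain σ s w z × par s z ≡ just (x , a)) → ⊥
          conflict-down top e edge k with trans (sym w↑v) e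
          ... | refl = ¬used (_ , subst (Edge s v _) (trans (sym (σσ _)) σβ) edge)
          conflict-down (down e′ σb≢b c) e edge k with trans (sym e′) e
          ... | refl = conflict-up c (λ σa≡a → σb≢b (cong σ σa≡a)) k

          conflict : ∀ {x y z a} → Chain σ s w x × par s x ≡ just (y , σ a) ⊎ Chain σ s w y × par s y ≡ just (x , σ a) →
            Edge s x z a → ¬ (Chain σ s w x) ⊎ (¬ Chain σ s w z × par s z ≡ just (x , a)) → ⊥
          conflict (inj₁ (c , e)) edge k = conflict-up c (chain-moved c e) k
          conflict (inj₂ (c , e)) edge k = conflict-down c e edge k

          data Sort (x y : Fin n) (a : Fin κ) : Set where
            kept    : Edge s x y a → ¬ (Chain σ s w x) ⊎ (¬ Chain σ s w y × par s y ≡ just (x , a)) → Sort x y a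
            flipped : Edge s x y (σ a) →
              Chain σ s w x × par s x ≡ just (y , σ a) ⊎ Chain σ s w y × par s y ≡ just (x , σ a) → Sort x y a

          sort : ∀ {x y a} → Origin x y a → Sort x y a
          sort (kept-up ¬c e)     = kept (upward e) (inj₁ ¬c)
          sort (kept-down ¬c e)   = kept (downward e) (inj₂ (¬c , e))
          sort (flipped-up c e)   = flipped (upward e) (inj₁ (c , e))
          sort (flipped-down c e) = flipped (downward e) (inj₂ (c , e))

          unique′ : ∀ {x y z a} → Sort x y a → Sort x z a → y ≡ z
          unique′ (kept e _)    (kept e′ _)    = unique prop e e′
          unique′ (flipped e _) (flipped e′ _) = unique prop e e′
          unique′ (flipped _ f) (kept e k)     = ⊥-elim (conflict f e k)
          unique′ (kept e k)    (flipped _ f)  = ⊥-elim (conflict f e k)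

        Flipped-Proper : Proper t
        Flipped-Proper = proper λ e e′ → unique′ (sort (origin e)) (sort (origin e′))

        Flipped-Used : ∀ {x a} → x ≢ v → ¬ Below r w x → (Used s x a → Used t x a) × (Used t x a → Used s x a)
        Flipped-Used {x} x≢v ¬b = (λ (y , e) → y , to e) , (λ (y , e) → y , from (origin e))
          where
          ¬chain : ¬ Chain σ s w x
          ¬chain c = ¬b (chain-below r⊢s c)
          ¬chain-child : ∀ {y a} → par s y ≡ just (x , a) → ¬ Chain σ s w y
          ¬chain-child e top with trans (sym e) w↑v
          ... | refl = x≢v refl
          ¬chain-child e (down e′ _ c) with trans (sym e) e′
          ... | refl = ¬chain c
          to : ∀ {y a} → Edge s x y a → Edge t x y a
          to (upward e)   = upward (trans (off F ¬chain) e)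
          to (downward e) = downward (trans (off F (¬chain-child e)) e)
          from : ∀ {y a} → Origin x y a → Edge s x y a
          from (kept-up _ e)      = upward e
          from (kept-down _ e)    = downward e
          from (flipped-up c _)   = ⊥-elim (¬chain c)
          from (flipped-down c e) = ⊥-elim (¬chain-child e c)

record IsSwap {κ : ℕ} (σ : Fin κ → Fin κ) (α β : Fin κ) : Set where
  field
    left       : σ α ≡ β
    right      : σ β ≡ α
    distinct   : α ≢ β
    involutive : ∀ a → σ (σ a) ≡ a
    moves      : ∀ {a} → σ a ≢ a → a ≡ α ⊎ a ≡ β

IsSwap-sym : ∀ {κ} {σ : Fin κ → Fin κ} {α β} → IsSwap σ α β → IsSwap σ β α
IsSwap-sym S = record
  { left = right ; right = left ; distinct = λ e → distinct (sym e) ; involutive = involutive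
  ; moves = λ m → [ inj₂ , inj₁ ]′ (moves m) }
  where open IsSwap S

transpose-IsSwap : ∀ {κ} {α β : Fin κ} → α ≢ β → IsSwap (transpose α β) α β
transpose-IsSwap {κ} {α} {β} α≢β = record
  { left = σα ; right = σβ ; distinct = α≢β ; involutive = σσ ; moves = moves }
  where
  σ : Fin κ → Fin κ
  σ = transpose α β
  σα : σ α ≡ β
  σα rewrite reflects-from (Dec.proof (α Fin.≟ α)) refl = refl
  σβ : σ β ≡ α
  σβ rewrite reflects-false (Dec.proof (β Fin.≟ α)) (λ e → α≢β (sym e))
           | reflects-from (Dec.proof (β Fin.≟ β)) refl = refl
  fixed : ∀ {a} → a ≢ α → a ≢ β → σ a ≡ a
  fixed {a} a≢α a≢β rewrite reflects-false (Dec.proof (a Fin.≟ α)) a≢α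
                          | reflects-false (Dec.proof (a Fin.≟ β)) a≢β = refl
  moves : ∀ {a} → σ a ≢ a → a ≡ α ⊎ a ≡ β
  moves {a} m = case ((a Fin.≟ α) , (a Fin.≟ β)) of λ
    { (yes e , _)     → inj₁ e
    ; (no _ , yes e)  → inj₂ e
    ; (no ¬e , no ¬f) → ⊥-elim (m (fixed ¬e ¬f)) }
  σσ : ∀ a → σ (σ a) ≡ a
  σσ a = case ((a Fin.≟ α) , (a Fin.≟ β)) of λ
    { (yes refl , _)    → trans (cong σ σα) σβ
    ; (no _ , yes refl) → trans (cong σ σβ) σα
    ; (no ¬e , no ¬f)   → trans (cong σ (fixed ¬e ¬f)) (fixed ¬e ¬f) }

module FixForbidden {n κ Δ : ℕ} where

  open Operations {n} {κ} {Δ}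
  open Kempe {n} {κ} {Δ}

  record FlippedBelow (σ : Fin κ → Fin κ) (v : Fin n) (s t : St n κ) : Set where
    field
      stay : par t v ≡ par s v
      on   : ∀ {x} → x ≢ v → Chain σ s v x → par t x ≡ Maybe.map (map₂ σ) (par s x)
      off  : ∀ {x} → ¬ Chain σ s v x → par t x ≡ par s x

  record ProperBelow (r : Shape n) (v : Fin n) (s : St n κ) : Set where
    field
      siblings : ∀ {p x y a} → Below r v p → par s x ≡ just (p , a) → par s y ≡ just (p , a) → x ≡ y
      vertical : ∀ {p x y a} → Below r v p → par s x ≡ just (p , a) → par s y ≢ just (x , a)

  module _ {r : Shape n} (ac : Acyclic r) where

    open Ranked ac

    ProperBelow-down : ∀ {s v w} → Below r v w → ProperBelow r v s → ProperBelow r w s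
    ProperBelow-down v≤w P = record
      { siblings = λ b → siblings (Below-trans v≤w b)
      ; vertical = λ b → vertical (Below-trans v≤w b) }
      where open ProperBelow P

    ProperBelow-recolor : ∀ {s w a} → r ⊢ s → ProperBelow r w s → ProperBelow r w (recolor s w a)
    ProperBelow-recolor {s} {w} {a} r⊢s P = record
      { siblings = λ b e e′ → siblings b (old b e) (old b e′)
      ; vertical = λ b e e′ → vertical b (old b e) (old (up (par⇒shape (recolor-⊢ r⊢s) e) b) e′) }
      where
      open ProperBelow P
      old : ∀ {p x c} → Below r w p → par (recolor s w a) x ≡ just (p , c) → par s x ≡ just (p , c)
      old {x = x} b e = trans (sym (recolor-other {s} {w} x≢w)) e
        where
        x≢w : x ≢ w
        x≢w refl = parent-not-below (par⇒shape (recolor-⊢ r⊢s) e) b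

    fixForbidden-flips : ∀ {σ} f {s v γ δ} → IsSwap σ γ δ → r ⊢ s → ProperBelow r v s →
      (∀ x → par s x ≢ just (v , γ)) → n ℕ.≤ f ℕ.+ rank v →
      FlippedBelow σ v s (fixForbidden f s v γ δ)
    fixForbidden-flips zero {v = v} S r⊢s P ¬γ n≤f = ⊥-elim (ℕ.<⇒≱ (rank<n v) n≤f)
    fixForbidden-flips {σ} (suc f) {s} {v} {γ} {δ} S r⊢s P ¬γ n≤f with childWithColor s v δ in cwc
    ... | nothing = record
      { stay = refl
      ; on   = λ x≢v c → ⊥-elim (x≢v (trivial c))
      ; off  = λ _ → refl }
      where
      trivial : ∀ {x} → Chain σ s v x → x ≡ v
      trivial top = refl
      trivial (down e m c) with trivial c
      ... | refl with IsSwap.moves S m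
      ...   | inj₁ refl = ⊥-elim (¬γ _ e)
      ...   | inj₂ refl = ⊥-elim (childWithColor-nothing {s} cwc _ e)
    ... | just w = record
      { stay = trans (off (λ c → parent-not-below w↑v (chain-below ac (recolor-⊢ r⊢s) c))) (recolor-other {s} v≢w)
      ; on   = λ {x} x≢v c → on-chain x≢v (narrow x≢v c)
      ; off  = λ {x} ¬c → trans (off (λ c → ¬c (widen c))) (recolor-other {s} (λ { refl → ¬c w∈chain })) }
      where
      open IsSwap S
      s′ : St n κ
      s′ = recolor s w γ
      pw : par s w ≡ just (v , δ)
      pw = childWithColor-just {s} cwc
      w↑v : r w ≡ just v
      w↑v = par⇒shape r⊢s pw
      v≢w : v ≢ w
      v≢w refl = no-loop w↑v
      ¬δ : ∀ x → par s′ x ≢ just (w , δ)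
      ¬δ x e = ProperBelow.vertical P here pw (trans (sym (recolor-other {s} x≢w)) e)
        where
        x≢w : x ≢ w
        x≢w refl = no-loop (par⇒shape (recolor-⊢ r⊢s) e)
      ih : FlippedBelow σ w s′ (fixForbidden f s′ w δ γ)
      ih = fixForbidden-flips f (IsSwap-sym S) (recolor-⊢ r⊢s) (ProperBelow-recolor r⊢s (ProperBelow-down (up w↑v here) P)) ¬δ
        (ℕ.≤-trans n≤f (ℕ.≤-trans (ℕ.≤-reflexive (sym (ℕ.+-suc f (rank v)))) (ℕ.+-monoʳ-≤ f (rank-< w↑v))))
      open FlippedBelow ih
      w∈chain : Chain σ s v w
      w∈chain = down pw (λ e → distinct (trans (sym right) e)) top
      widen : ∀ {x} → Chain σ s′ w x → Chain σ s v x
      widen top = w∈chain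
      widen {x} (down e m c) with x Fin.≟ w
      ... | yes refl = w∈chain
      ... | no x≢w   = down (trans (sym (recolor-other {s} x≢w)) e) m (widen c)
      narrow : ∀ {x} → x ≢ v → Chain σ s v x → Chain σ s′ w x
      narrow x≢v top = ⊥-elim (x≢v refl)
      narrow {x} x≢v (down {p = p} e m c) with x Fin.≟ w | p Fin.≟ v
      ... | yes refl | _      = top
      ... | no x≢w   | no p≢v = down (trans (recolor-other {s} x≢w) e) m (narrow p≢v c)
      ... | no x≢w   | yes refl with moves m
      ...   | inj₁ refl = ⊥-elim (¬γ x e)
      ...   | inj₂ refl = ⊥-elim (x≢w (ProperBelow.siblings P here e pw))
      on-chain : ∀ {x} → x ≢ v → Chain σ s′ w x → par (fixForbidden f s′ w δ γ) x ≡ Maybe.map (map₂ σ) (par s x)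
      on-chain {x} x≢v c with x Fin.≟ w
      ... | no x≢w   = trans (on x≢w c) (cong (Maybe.map (map₂ σ)) (recolor-other {s} x≢w))
      ... | yes refl = trans stay (trans (recolor-same {s} pw)
              (sym (trans (cong (Maybe.map (map₂ σ)) pw) (cong (λ c → just (v , c)) right))))

    flip-Flipped : ∀ {σ s v w α β} → IsSwap σ α β → r ⊢ s → par s w ≡ just (v , β) → ProperBelow r w s →
      (∀ x → par s x ≢ just (w , β)) →
      Flipped σ w s (fixForbidden (suc n) (recolor s w α) w β α)
    flip-Flipped {σ} {s} {v} {w} {α} {β} S r⊢s pw P ¬β = record
      { on  = on-chain
      ; off = λ ¬c → trans (off (λ c → ¬c (chain-old c))) (recolor-other {s} (λ { refl → ¬c top })) }
      where
      open IsSwap S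
      s′ : St n κ
      s′ = recolor s w α
      w↑v : r w ≡ just v
      w↑v = par⇒shape r⊢s pw
      ¬β′ : ∀ x → par s′ x ≢ just (w , β)
      ¬β′ x e = ¬β x (trans (sym (recolor-other {s} x≢w)) e)
        where
        x≢w : x ≢ w
        x≢w refl = no-loop (par⇒shape (recolor-⊢ r⊢s) e)
      open FlippedBelow (fixForbidden-flips (suc n) (IsSwap-sym S) (recolor-⊢ r⊢s) (ProperBelow-recolor r⊢s P) ¬β′
        (ℕ.m≤n⇒m≤1+n (ℕ.m≤m+n n (rank w))))
      chain-old : ∀ {x} → Chain σ s′ w x → Chain σ s w x
      chain-old top = top
      chain-old {x} (down e m c) with x Fin.≟ w
      ... | yes refl = top
      ... | no x≢w   = down (trans (sym (recolor-other {s} x≢w)) e) m (chain-old c)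
      chain-new : ∀ {x} → Chain σ s w x → Chain σ s′ w x
      chain-new top = top
      chain-new {x} (down e m c) with x Fin.≟ w
      ... | yes refl = top
      ... | no x≢w   = down (trans (recolor-other {s} x≢w) e) m (chain-new c)
      on-chain : ∀ {x} → Chain σ s w x → par (fixForbidden (suc n) s′ w β α) x ≡ Maybe.map (map₂ σ) (par s x)
      on-chain {x} c with x Fin.≟ w
      ... | no x≢w   = trans (on x≢w (chain-new c)) (cong (Maybe.map (map₂ σ)) (recolor-other {s} x≢w))
      ... | yes refl = trans stay (trans (recolor-same {s} pw)
              (sym (trans (cong (Maybe.map (map₂ σ)) pw) (cong (λ c → just (v , c)) right))))

  flipWith : St n κ → Fin n → Fin κ → Maybe (Fin κ) → St n κ
  flipWith t w b (just a) = fixForbidden (suc n) (recolor t w b) w a b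
  flipWith t w b nothing  = t

  flipTo : St n κ → Fin n → Fin κ → St n κ
  flipTo t w b = flipWith t w b (colOf t w)

  flipTo-just : ∀ t {w b p a} → par t w ≡ just (p , a) → flipTo t w b ≡ fixForbidden (suc n) (recolor t w b) w a b
  flipTo-just t {w} {b} e = cong (flipWith t w b) (colOf-just t w e)

module Reroot {n κ Δ : ℕ} where

  open Operations {n} {κ} {Δ}
  open Kempe {n} {κ} {Δ} using (Below-trans)

  module _ {r : Shape n} (ac : Acyclic r) where

    open Ranked ac

    below? : ∀ x v → Dec (Below r x v)
    below? x v = go (proj₂ (ac v))
      where
      go : ∀ {v d} → Depth r v d → Dec (Below r x v)
      go {v} D with x Fin.≟ v
      go D           | yes refl = yes here
      go (isRoot e)    | no x≢v = no λ { here → x≢v refl ; (up e′ _) → just≢nothing (trans (sym e′) e) }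
      go (isChild e D) | no x≢v with go D
      ... | yes b = yes (up e b)
      ... | no ¬b = no λ { here → x≢v refl
                         ; (up e′ b) → ¬b (subst (Below r x) (Maybe.just-injective (trans (sym e′) e)) b) }

    path-child : ∀ {x v} → Below r x v → x ≢ v → ∃ λ y → r y ≡ just x × Below r y v
    path-child here x≢v = ⊥-elim (x≢v refl)
    path-child {x} (up {p = p} e b) x≢v with x Fin.≟ p
    ... | yes refl = _ , e , here
    ... | no x≢p with path-child b x≢p
    ...   | y , e′ , b′ = y , e′ , up e b′

    record Rerooted (v : Fin n) (new : Maybe (Fin n × Fin κ)) (s t : St n κ) : Set where
      field
        start    : par t v ≡ new
        reversed : ∀ {x y c} → Below r y v → par s y ≡ just (x , c) → par t x ≡ just (y , c)
        kept     : ∀ {x} → ¬ Below r x v → par t x ≡ par s x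
    open Rerooted

    rerootAttach-Rerooted : ∀ {s v new} → r ⊢ s → Rerooted v new s (rerootAttach (suc n) s v new)
    rerootAttach-Rerooted {s} {v} {new} r⊢s = record
      { start = proj₁ spec ; reversed = proj₁ (proj₂ spec) ; kept = proj₂ (proj₂ spec) }
      where
      Spec : St n κ → Fin n → Maybe (Fin n × Fin κ) → St n κ → Set
      Spec s′ v new t =
        par t v ≡ new ×
        (∀ {x y c} → Below r y v → par s y ≡ just (x , c) → par t x ≡ just (y , c)) ×
        (∀ {x} → ¬ Below r x v → par t x ≡ par s′ x)
      go : ∀ f {s′ v new} → rank v ℕ.< f → (∀ {x} → Below r x v → par s′ x ≡ par s x) →
        Spec s′ v new (rerootAttach f s′ v new)
      go (suc f) {s′} {v} {new} v<f agree with par s′ v in pv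
      ... | nothing =
        setPar-same s′ v new ,
        (λ b e → ⊥-elim (root-top (shape-root b) b e)) ,
        (λ ¬b → setPar-other {s = s′} {v} (λ { refl → ¬b here }))
        where
        shape-root : ∀ {y} → Below r y v → y ≡ v
        shape-root here = refl
        shape-root (up e _) with shape⇒par r⊢s e
        ... | _ , e′ = ⊥-elim (just≢nothing (trans (sym e′) (trans (sym (agree here)) pv)))
        root-top : ∀ {x y c} → y ≡ v → Below r y v → par s y ≡ just (x , c) → ⊥
        root-top refl _ e = just≢nothing (trans (sym e) (trans (sym (agree here)) pv))
      ... | just (p , c) =
        trans (proj₂ (proj₂ ih) (parent-not-below v↑p)) (setPar-same s′ v new) ,
        rev ,
        (λ ¬b → trans (proj₂ (proj₂ ih) (λ b → ¬b (up v↑p b))) (setPar-other {s = s′} {v} (λ { refl → ¬b here })))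
        where
        psv : par s v ≡ just (p , c)
        psv = trans (sym (agree here)) pv
        v↑p : r v ≡ just p
        v↑p = par⇒shape r⊢s psv
        ih : Spec (setPar s′ v new) p (just (v , c)) (rerootAttach f (setPar s′ v new) p (just (v , c)))
        ih = go f (ℕ.<-≤-trans (rank-< v↑p) (ℕ.s≤s⁻¹ v<f))
          (λ b → trans (setPar-other {s = s′} {v} (λ { refl → parent-not-below v↑p b })) (agree (up v↑p b)))
        rev : ∀ {x y c′} → Below r y v → par s y ≡ just (x , c′) →
          par (rerootAttach f (setPar s′ v new) p (just (v , c))) x ≡ just (y , c′)
        rev here e with trans (sym psv) e
        ... | refl = proj₁ ih
        rev (up e′ b) e with trans (sym v↑p) e′
        ... | refl = proj₁ (proj₂ ih) b e
      spec : Spec s v new (rerootAttach (suc n) s v new)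
      spec = go (suc n) (ℕ.<-trans (rank<n v) (ℕ.n<1+n n)) (λ _ → refl)

    Rerooted-attach : ∀ {s t t′ v new new′} → r ⊢ s → Rerooted v new s t → Rerooted v new′ s t′ →
      t′ ≈ setPar t v new′
    Rerooted-attach {s} {t} {t′} {v} {new} {new′} r⊢s R R′ = pointwise go
      where
      go : ∀ x → par t′ x ≡ par (setPar t v new′) x
      go x with x Fin.≟ v
      ... | yes refl = start R′
      ... | no x≢v with below? x v
      ...   | no ¬b = trans (kept R′ ¬b) (sym (kept R ¬b))
      ...   | yes b with path-child b x≢v
      ...     | y , e , b′ with shape⇒par r⊢s e
      ...       | c , e′ = trans (reversed R′ b′ e′) (sym (reversed R b′ e′))

    Rerooted-⊢ : ∀ {s s′ t t′ v} → r ⊢ s → r ⊢ s′ → Rerooted v nothing s t → Rerooted v nothing s′ t′ →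
      shape t ⊢ t′
    Rerooted-⊢ {s} {s′} {t} {t′} {v} r⊢s r⊢s′ R R′ = shaped go
      where
      go : ∀ x → shape t′ x ≡ shape t x
      go x with x Fin.≟ v
      ... | yes refl = cong (Maybe.map proj₁) (trans (start R′) (sym (start R)))
      ... | no x≢v with below? x v
      ...   | no ¬b = trans (cong (Maybe.map proj₁) (kept R′ ¬b))
                        (trans (trans (shape-at r⊢s′ x) (sym (shape-at r⊢s x)))
                               (cong (Maybe.map proj₁) (sym (kept R ¬b))))
      ...   | yes b with path-child b x≢v
      ...     | y , e , b′ with shape⇒par r⊢s e | shape⇒par r⊢s′ e
      ...       | _ , e₁ | _ , e₂ = trans (cong (Maybe.map proj₁) (reversed R′ b′ e₂))
                                          (cong (Maybe.map proj₁) (sym (reversed R b′ e₁)))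

    module _ {s t v} (r⊢s : r ⊢ s) (R : Rerooted v nothing s t) where

      Rerooted-SameEdges : SameEdges s t
      Rerooted-SameEdges = record
        { edge-to   = λ { (upward e) → to e ; (downward e) → Edge-sym (to e) }
        ; edge-from = λ { (upward e) → from e ; (downward e) → Edge-sym (from e) } }
        where
        to : ∀ {x y a} → par s x ≡ just (y , a) → Edge t x y a
        to {x} e with below? x v
        ... | yes b = downward (reversed R b e)
        ... | no ¬b = upward (trans (kept R ¬b) e)
        from : ∀ {x y a} → par t x ≡ just (y , a) → Edge s x y a
        from {x} e with x Fin.≟ v
        ... | yes refl = ⊥-elim (just≢nothing (trans (sym e) (start R)))
        ... | no x≢v with below? x v
        ...   | no ¬b = upward (trans (sym (kept R ¬b)) e)
        ...   | yes b with path-child b x≢v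
        ...     | y , e′ , b′ with shape⇒par r⊢s e′
        ...       | c , e″ with trans (sym e) (reversed R b′ e″)
        ...         | refl = downward e″

      Rerooted-Acyclic : Acyclic (shape t)
      Rerooted-Acyclic x = go (proj₂ (ac x))
        where
        on-path : ∀ {x z d} → Below r z v → Depth (shape t) z d → Below r x z → ∃ (Depth (shape t) x)
        on-path b D here = _ , D
        on-path b D (up e b′) with shape⇒par r⊢s e
        ... | _ , e′ =
          on-path (Below-trans (up e here) b) (isChild (cong (Maybe.map proj₁) (reversed R b e′)) D) b′
        go : ∀ {x d} → Depth r x d → ∃ (Depth (shape t) x)
        go {x} D with below? x v
        go D | yes b = on-path here (isRoot (cong (Maybe.map proj₁) (start R))) b
        go {x} (isRoot e)    | no ¬b = _ , isRoot (trans (trans (cong (Maybe.map proj₁) (kept R ¬b)) (shape-at r⊢s x)) e)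
        go {x} (isChild e D) | no ¬b =
          _ , isChild (trans (trans (cong (Maybe.map proj₁) (kept R ¬b)) (shape-at r⊢s x)) e) (proj₂ (go D))

module Kernels {n κ Δ : ℕ} (rq : Shape n) (ac : Acyclic rq) (u v : Fin n)
  (v-root : rq v ≡ nothing) (u≰v : ¬ Below rq v u) where

  open Operations {n} {κ} {Δ} public
  open Kempe {n} {κ} {Δ} public
  open FixForbidden {n} {κ} {Δ} public
  open IsSwap using (distinct; involutive; right)

  u≢v : u ≢ v
  u≢v refl = u≰v here

  record Coloured (q : St n κ) : Set where
    constructor coloured
    field
      shp  : rq ⊢ q
      prop : Proper q
  open Coloured public

  -- Only properness at and below w matters: the chain never leaves the subtree of w.
  Proper⇒Below : ∀ {r s w} → Acyclic r → r ⊢ s →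
    (∀ {x y z a} → Below r w x → Edge s x y a → Edge s x z a → y ≡ z) → ProperBelow r w s
  Proper⇒Below ac′ r⊢s uniq = record
    { siblings = λ b e e′ → uniq b (downward e) (downward e′)
    ; vertical = λ b e e′ → Ranked.no-2-cycle ac′ (par⇒shape r⊢s e)
        (trans (cong _ (uniq (up (par⇒shape r⊢s e) b) (upward e) (downward e′))) (par⇒shape r⊢s e′)) }

  flipTo-Flipped : ∀ {σ t w a b} → IsSwap σ b a → Coloured t → par t w ≡ just (v , a) → Flipped σ w t (flipTo t w b)
  flipTo-Flipped {t = t} S C e = subst (Flipped _ _ t) (sym (flipTo-just t e))
    (flip-Flipped ac S (shp C) e below (λ x e′ → ProperBelow.vertical below here e e′))
    where
    below : ∀ {x} → ProperBelow rq x t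
    below = Proper⇒Below ac (shp C) (λ _ → unique (prop C))

  Flipped-resp : ∀ {σ w s t t′} → t ≈ t′ → Flipped σ w s t → Flipped σ w s t′
  Flipped-resp t≈t′ F = record
    { on  = λ c → trans (sym (at t≈t′ _)) (Flipped.on F c)
    ; off = λ c → trans (sym (at t≈t′ _)) (Flipped.off F c) }

  module _ {t w a b} (C : Coloured t) (e : par t w ≡ just (v , a)) (¬b : ¬ Used t v b) where

    flipTo-swap : IsSwap (transpose b a) b a
    flipTo-swap = transpose-IsSwap λ { refl → ¬b (w , downward e) }

    private
      F : Flipped (transpose b a) w t (flipTo t w b)
      F = flipTo-Flipped flipTo-swap C e
      σσ : ∀ c → transpose b a (transpose b a c) ≡ c
      σσ = involutive flipTo-swap

    flipTo-coloured : Coloured (flipTo t w b)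
    flipTo-coloured = coloured (Flipped-⊢ ac (shp C) F)
      (Flipped-Proper ac σσ (shp C) F e (right flipTo-swap) (λ e → distinct flipTo-swap (sym e)) ¬b (prop C))

    flipTo-colour : par (flipTo t w b) w ≡ just (v , b)
    flipTo-colour = new-colour ac σσ (shp C) F e (right flipTo-swap) (λ e → distinct flipTo-swap (sym e)) ¬b (prop C)

    flipTo-frees : ¬ Used (flipTo t w b) v a
    flipTo-frees = Flipped-¬Used ac σσ (shp C) F e (right flipTo-swap) (λ e → distinct flipTo-swap (sym e)) ¬b (prop C)

    flipTo-Used-u : ∀ {c} → (Used t u c → Used (flipTo t w b) u c) × (Used (flipTo t w b) u c → Used t u c)
    flipTo-Used-u = Flipped-Used ac σσ (shp C) F e (right flipTo-swap) (λ e → distinct flipTo-swap (sym e)) ¬b (prop C)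
      u≢v (λ b → u≰v (Below-trans (up (par⇒shape (shp C) e) here) b))

    flipTo-inverse : ∀ {q} → flipTo t w b ≈ q → t ≈ flipTo q w a
    flipTo-inverse {q} z≈q = Flipped-functional ac rq⊢q
      (Flipped-sym ac σσ (shp C) (Flipped-resp z≈q F))
      (flipTo-Flipped (IsSwap-sym flipTo-swap) (coloured rq⊢q (Proper-resp z≈q (prop flipTo-coloured)))
        (trans (sym (at z≈q w)) flipTo-colour))
      where
      rq⊢q : rq ⊢ q
      rq⊢q = ⊢-resp z≈q (shp flipTo-coloured)

  attach : St n κ → Fin κ → St n κ
  attach q a = setPar q v (just (u , a))

  detach : St n κ → St n κ
  detach t = setPar t v nothing

  r⁺ : Shape n
  r⁺ x = if x == v then just u else rq x

  r⁺-v : r⁺ v ≡ just u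
  r⁺-v rewrite reflects-from (==-reflects v v) refl = refl

  r⁺-other : ∀ {x} → x ≢ v → r⁺ x ≡ rq x
  r⁺-other {x} x≢v rewrite reflects-false (==-reflects x v) x≢v = refl

  ac⁺ : Acyclic r⁺
  ac⁺ = Acyclic-attach r⁺-other ac r⁺-v u≰v

  attach-⊢ : ∀ {q a} → rq ⊢ q → r⁺ ⊢ attach q a
  attach-⊢ {q} {a} rq⊢q = shaped go
    where
    go : ∀ x → shape (attach q a) x ≡ r⁺ x
    go x with x Fin.≟ v
    ... | yes refl = refl
    ... | no x≢v   = shape-at rq⊢q x

  detach-⊢ : ∀ {t} → r⁺ ⊢ t → rq ⊢ detach t
  detach-⊢ {t} r⁺⊢t = shaped go
    where
    go : ∀ x → shape (detach t) x ≡ rq x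
    go x with x Fin.≟ v
    ... | yes refl = sym v-root
    ... | no x≢v   = trans (shape-at r⁺⊢t x) (r⁺-other x≢v)

  attach-v : ∀ {q a} → par (attach q a) v ≡ just (u , a)
  attach-v {q} = setPar-same q v _

  attach-other : ∀ {q a x} → x ≢ v → par (attach q a) x ≡ par q x
  attach-other {q} = setPar-other {s = q}

  attach-detach : ∀ {t a} → par t v ≡ just (u , a) → t ≈ attach (detach t) a
  attach-detach {t} {a} e = pointwise go
    where
    go : ∀ x → par t x ≡ par (attach (detach t) a) x
    go x with x Fin.≟ v
    ... | yes refl = e
    ... | no x≢v   = refl

  attach-cong : ∀ {q t a} → q ≈ t → attach q a ≈ attach t a
  attach-cong {q} {t} {a} q≈t = pointwise go
    where
    go : ∀ x → par (attach q a) x ≡ par (attach t a) x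
    go x with x Fin.≟ v
    ... | yes refl = refl
    ... | no x≢v   = at q≈t x

  attach-colour : ∀ {q t a b} → attach q a ≈ attach t b → a ≡ b
  attach-colour {q} {t} e with trans (sym (attach-v {q})) (trans (at e v) (attach-v {t}))
  ... | refl = refl

  attach-injective : ∀ {q t a b} → rq ⊢ q → rq ⊢ t → attach q a ≈ attach t b → q ≈ t
  attach-injective {q} {t} {a} {b} rq⊢q rq⊢t e = pointwise go
    where
    go : ∀ x → par q x ≡ par t x
    go x with x Fin.≟ v
    ... | yes refl = trans (shape⇒root rq⊢q v-root) (sym (shape⇒root rq⊢t v-root))
    ... | no x≢v   = trans (sym (attach-other {q} x≢v)) (trans (at e x) (attach-other {t} x≢v))

  attach-edge : ∀ {q x y a b} → rq ⊢ q → Edge q x y b → Edge (attach q a) x y b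
  attach-edge {q} {a = a} rq⊢q = λ { (upward e) → upward (go e) ; (downward e) → downward (go e) }
    where
    go : ∀ {x y b} → par q x ≡ just (y , b) → par (attach q a) x ≡ just (y , b)
    go e = trans (attach-other {q} λ { refl → just≢nothing (trans (sym (par⇒shape rq⊢q e)) v-root) }) e

  data AttachEdge (q : St n κ) (a : Fin κ) : Fin n → Fin n → Fin κ → Set where
    old : ∀ {x y b} → Edge q x y b → AttachEdge q a x y b
    new : AttachEdge q a v u a
    wen : AttachEdge q a u v a

  edge-attach : ∀ {q x y a b} → Edge (attach q a) x y b → AttachEdge q a x y b
  edge-attach {q} {x} {y} {a} (upward e) with x Fin.≟ v
  edge-attach {q} {a = a} (upward refl) | yes refl = new
  ... | no x≢v = old (upward e)
  edge-attach {q} {x} {y} {a} (downward e) with y Fin.≟ v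
  edge-attach {q} {a = a} (downward refl) | yes refl = wen
  ... | no y≢v = old (downward e)

  attach-proper : ∀ {q a} → Proper q → ¬ Used q u a → ¬ Used q v a → Proper (attach q a)
  attach-proper {q} {a} pr ¬u ¬v = proper λ e e′ → go (edge-attach e) (edge-attach e′)
    where
    go : ∀ {x y z b} → AttachEdge q a x y b → AttachEdge q a x z b → y ≡ z
    go (old e) (old e′) = unique pr e e′
    go (old e) new = ⊥-elim (¬v (_ , e))
    go (old e) wen = ⊥-elim (¬u (_ , e))
    go new (old e) = ⊥-elim (¬v (_ , e))
    go wen (old e) = ⊥-elim (¬u (_ , e))
    go new new = refl
    go wen wen = refl
    go new wen = ⊥-elim (u≢v refl)
    go wen new = ⊥-elim (u≢v refl)

  record Attached (t′ : St n κ) : Set where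
    base : St n κ
    base = detach t′
    field
      colour        : Fin κ
      parent        : par t′ v ≡ just (u , colour)
      base-coloured : Coloured base
      free-u        : ¬ Used base u colour
      free-v        : ¬ Used base v colour
    equal : t′ ≈ attach base colour
    equal = attach-detach parent

  attached : ∀ {t′} → r⁺ ⊢ t′ → Proper t′ → Attached t′
  attached {t′} r⁺⊢t′ pr with shape⇒par r⁺⊢t′ r⁺-v
  ... | a , e = record
    { colour = a ; parent = e
    ; base-coloured = coloured rq⊢t (proper λ e₁ e₂ → unique pr (old-edge e₁) (old-edge e₂))
    ; free-u = λ (y , e₁) → not-uv (subst (λ z → Edge (detach t′) u z a) (unique pr (old-edge e₁) (downward e)) e₁)
    ; free-v = λ (y , e₁) → not-uv (Edge-sym (subst (λ z → Edge (detach t′) v z a) (unique pr (old-edge e₁) (upward e)) e₁)) }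
    where
    rq⊢t : rq ⊢ detach t′
    rq⊢t = detach-⊢ r⁺⊢t′
    old-edge : ∀ {x y b} → Edge (detach t′) x y b → Edge t′ x y b
    old-edge e₁ = Edge-resp (≈-sym (attach-detach e)) (attach-edge rq⊢t e₁)
    not-uv : ∀ {b} → ¬ Edge (detach t′) u v b
    not-uv (upward e₁)   = u≰v (up (par⇒shape rq⊢t e₁) here)
    not-uv (downward e₁) = just≢nothing (trans (sym (par⇒shape rq⊢t e₁)) v-root)

  -- The chain below w is the same before and after v is attached.
  fixForbidden-attach : ∀ {q s w a b c} → Coloured q → s ≈ attach q c → par q w ≡ just (v , a) → a ≢ b →
    fixForbidden (suc n) (recolor s w b) w a b ≈ attach (flipTo q w b) c
  fixForbidden-attach {q} {s} {w} {a} {b} {c} C s≈ e a≢b = pointwise go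
    where
    S : IsSwap (transpose b a) b a
    S = transpose-IsSwap λ { refl → a≢b refl }
    σ : Fin κ → Fin κ
    σ = transpose b a
    y : St n κ
    y = fixForbidden (suc n) (recolor s w b) w a b
    r⁺⊢s : r⁺ ⊢ s
    r⁺⊢s = ⊢-resp (≈-sym s≈) (attach-⊢ (shp C))
    w≢v : w ≢ v
    w≢v refl = just≢nothing (trans (sym (par⇒shape (shp C) e)) v-root)
    s-other : ∀ {x} → x ≢ v → par s x ≡ par q x
    s-other x≢v = trans (at s≈ _) (attach-other {q} x≢v)
    s-w : par s w ≡ just (v , a)
    s-w = trans (s-other w≢v) e
    w↑v : r⁺ w ≡ just v
    w↑v = par⇒shape r⁺⊢s s-w
    v≰ : ¬ Below r⁺ w v
    v≰ = Ranked.parent-not-below ac⁺ w↑v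
    u≰ : ¬ Below r⁺ w u
    u≰ b = Ranked.parent-not-below ac⁺ r⁺-v (Below-trans (up w↑v here) b)
    old-edge : ∀ {x y d} → Below r⁺ w x → Edge s x y d → Edge q x y d
    old-edge b (upward e₁) = upward (trans (sym (s-other λ { refl → v≰ b })) e₁)
    old-edge {x} b (downward e₁) = downward (trans (sym (s-other λ { refl → u≰ (subst (Below r⁺ w) (x≡u e₁) b) })) e₁)
      where
      x≡u : ∀ {d} → par s v ≡ just (x , d) → x ≡ u
      x≡u e₂ = Maybe.just-injective (trans (sym (par⇒shape r⁺⊢s e₂)) r⁺-v)
    F : Flipped σ w s y
    F = flip-Flipped ac⁺ S r⁺⊢s s-w
      (Proper⇒Below ac⁺ r⁺⊢s (λ b e₁ e₂ → unique (prop C) (old-edge b e₁) (old-edge b e₂)))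
      (λ x e₁ → Ranked.no-2-cycle ac⁺ w↑v
        (subst (λ z → r⁺ z ≡ just w) (unique (prop C) (old-edge here (downward e₁)) (old-edge here (upward s-w))) (par⇒shape r⁺⊢s e₁)))
    F′ : Flipped σ w q (flipTo q w b)
    F′ = flipTo-Flipped S C e
    inside : ∀ {x} → Chain σ s w x → Chain σ q w x
    inside top = top
    inside (down e₁ m c) with chain-below ac⁺ r⁺⊢s (down e₁ m c)
    ... | b = down (trans (sym (s-other λ { refl → v≰ b })) e₁) m (inside c)
    outside : ∀ {x} → Chain σ q w x → Chain σ s w x
    outside top = top
    outside (down e₁ m c) =
      down (trans (s-other λ { refl → just≢nothing (trans (sym (par⇒shape (shp C) e₁)) v-root) }) e₁) m (outside c)
    go : ∀ x → par y x ≡ par (attach (flipTo q w b) c) x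
    go x with x Fin.≟ v
    ... | yes refl = trans (Flipped.off F (λ c → v≰ (chain-below ac⁺ r⁺⊢s c))) (trans (at s≈ v) (attach-v {q}))
    ... | no x≢v with chain? ac⁺ r⁺⊢s x
    ...   | yes c = trans (Flipped.on F c) (trans (cong (Maybe.map (map₂ σ)) (s-other x≢v)) (sym (Flipped.on F′ (inside c))))
    ...   | no ¬c = trans (Flipped.off F ¬c) (trans (s-other x≢v) (sym (Flipped.off F′ (λ c → ¬c (outside c)))))

  record Prepared (s q : St n κ) : Set where
    field
      avail-u  : avail s u ≡ avail q u
      attaches : ∀ β → rerootAttach (suc n) s v (just (u , β)) ≈ attach q β

  ¬Used-v : ∀ {q β} → Coloured q → childWithColor q v β ≡ nothing → ¬ Used q v β
  ¬Used-v C e (y , upward e′)   = just≢nothing (trans (sym (par⇒shape (shp C) e′)) v-root)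
  ¬Used-v {q} C e (y , downward e′) = childWithColor-nothing {q} e y e′

  module _ {q : St n κ} (C : Coloured q) {s₁ : St n κ} {β : Fin κ} (s₁≈ : s₁ ≈ attach q β) where

    childWithColor-attach : childWithColor s₁ v β ≡ childWithColor q v β
    childWithColor-attach = cong head (filter-cong λ x →
      reflects-≡ (coloured-reflects s₁ x v β) (coloured-reflects q x v β) to from)
      where
      to : ∀ {x} → par s₁ x ≡ just (v , β) → par q x ≡ just (v , β)
      to e with edge-attach {q} (Edge-resp s₁≈ (upward e))
      ... | old (upward e′) = e′
      ... | old (downward e′) = ⊥-elim (just≢nothing (trans (sym (par⇒shape (shp C) e′)) v-root))
      ... | new = ⊥-elim (u≢v refl)
      ... | wen with trans (sym (at s₁≈ u)) e
      ...   | e′ = trans (sym (attach-other {q} u≢v)) e′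
      from : ∀ {x} → par q x ≡ just (v , β) → par s₁ x ≡ just (v , β)
      from e = trans (at s₁≈ _) (trans (attach-other {q} λ { refl → just≢nothing (trans (sym (par⇒shape (shp C) e)) v-root) }) e)

    module _ (β-used : Used q v β) where

      private
        to : ∀ {a} → Used s₁ v a → Used q v a
        to (y , e) = go (edge-attach {q} (Edge-resp s₁≈ e)) refl
          where
          go : ∀ {x y a} → AttachEdge q β x y a → x ≡ v → Used q v a
          go (old e) refl = _ , e
          go new refl = β-used
          go wen e = ⊥-elim (u≢v e)
        from : ∀ {a} → Used q v a → Used s₁ v a
        from (y , e) = y , Edge-resp (≈-sym s₁≈) (attach-edge (shp C) e)

      used-attach : ∀ a → used s₁ v a ≡ used q v a
      used-attach a = reflects-≡ (used-reflects s₁ v a) (used-reflects q v a) to from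

      avail-attach : avail s₁ v ≡ avail q v
      avail-attach = filter-cong (λ a → cong not (used-attach a))

  module _ (F : St n κ → ℚ) (F-resp : ∀ {s t} → s ≈ t → F s ≡ F t) where

    recolouring : St n κ → Fin κ → Maybe (Fin n) → ℚ
    recolouring q β nothing  = F (attach q β)
    recolouring q β (just w) =
      ∑ κ (λ α → if not (used q v α) then F (attach (flipTo q w α) β) else 0ℚ) * inv (length (avail q v))

    Ex-insertNamed : ∀ {s q} → Coloured q → Prepared s q →
      Ex (insertNamed s u v) F ≡
      ∑ κ (λ β → if not (used q u β) then recolouring q β (childWithColor q v β) else 0ℚ) * inv (length (avail q u))
    Ex-insertNamed {s} {q} C P = begin
      Ex (insertNamed s u v) F
        ≡⟨ cong (_* inv (length (avail s u))) (∑-cong (length (avail s u)) inner) ⟩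
      ∑ (length (avail s u)) (λ i → rec (lookup (avail s u) i)) * inv (length (avail s u))
        ≡⟨ cong (λ xs → ∑ (length xs) (λ i → rec (lookup xs i)) * inv (length xs)) avail-u ⟩
      ∑ (length (avail q u)) (λ i → rec (lookup (avail q u) i)) * inv (length (avail q u))
        ≡⟨ cong (_* inv (length (avail q u))) (∑-filter κ (λ β → not (used q u β)) rec) ⟩
      ∑ κ (λ β → if not (used q u β) then rec β else 0ℚ) * inv (length (avail q u)) ∎
      where
      open ≡-Reasoning
      open Prepared P
      rec : Fin κ → ℚ
      rec β = recolouring q β (childWithColor q v β)
      recoloured : ∀ {s₁ β w} → s₁ ≈ attach q β → childWithColor q v β ≡ just w →
        ∑ (length (avail s₁ v)) (λ j → F (fixForbidden (suc n) (recolor s₁ w (lookup (avail s₁ v) j)) w β (lookup (avail s₁ v) j)))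
          * inv (length (avail s₁ v)) ≡ recolouring q β (just w)
      recoloured {s₁} {β} {w} s₁≈ e = cong₂ _*_
        (trans (∑-filter κ (λ a → not (used s₁ v a)) (λ α → F (fixForbidden (suc n) (recolor s₁ w α) w β α)))
          (∑-cong κ λ α → trans (cong (λ b → if not b then F (fixForbidden (suc n) (recolor s₁ w α) w β α) else 0ℚ)
                                      (used-attach C s₁≈ β-used α))
            (if-cong (not (used q v α)) λ free → F-resp (fixForbidden-attach C s₁≈ pw
              λ { refl → reflects-to (available-reflects q v α) free β-used }))))
        (cong (λ xs → inv (length xs)) (avail-attach C s₁≈ β-used))
        where
        pw : par q w ≡ just (v , β)
        pw = childWithColor-just {q} e
        β-used : Used q v β
        β-used = w , downward pw
      inner : ∀ i → Ex (body (insertNamed s u v) i) F ≡ rec (lookup (avail s u) i)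
      inner i rewrite childWithColor-attach C (attaches (lookup (avail s u) i))
        with childWithColor q v (lookup (avail s u) i) in eq
      ... | nothing = F-resp (attaches (lookup (avail s u) i))
      ... | just w  = recoloured (attaches (lookup (avail s u) i)) eq

  module _ {q : St n κ} (C : Coloured q) {t′ : St n κ} (A : Attached t′) where

    open Attached A renaming (base to t; colour to β; base-coloured to Ct)

    private
      is-t′ : St n κ → ℚ
      is-t′ s = [ s ≈? t′ ]

      is-t′-resp : ∀ {s s′} → s ≈ s′ → is-t′ s ≡ is-t′ s′
      is-t′-resp {s} {s′} s≈s′ = []-cong (s ≈? t′) (s′ ≈? t′) (≈-trans (≈-sym s≈s′)) (≈-trans s≈s′)

      rec : Fin κ → Maybe (Fin n) → ℚ
      rec = recolouring is-t′ is-t′-resp q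

      k : ℕ
      k = length (avail q v)

      flips : Fin n → ℚ
      flips w = if isPar t w v then [ q ≈? flipTo t w β ] else 0ℚ

      rec-zero : ∀ β′ mw → β′ ≢ β → rec β′ mw ≡ 0ℚ
      rec-zero β′ nothing ne = []-false (attach q β′ ≈? t′) (λ e → ne (attach-colour {q} {t} (≈-trans e equal)))
      rec-zero β′ (just w) ne =
        trans (cong (_* inv k) (∑-zero κ _ (λ α → if-zero (not (used q v α))
                (λ _ → []-false (attach (flipTo q w α) β′ ≈? t′)
                         (λ e → ne (attach-colour {flipTo q w α} {t} (≈-trans e equal)))))))
              (*-zeroˡ (inv k))

      attach-iff : ∀ {q′} → rq ⊢ q′ → [ attach q′ β ≈? t′ ] ≡ [ q′ ≈? t ]
      attach-iff {q′} rq⊢q′ = []-cong (attach q′ β ≈? t′) (q′ ≈? t)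
        (λ e → attach-injective rq⊢q′ (shp Ct) (≈-trans e equal))
        (λ e → ≈-trans (attach-cong e) (≈-sym equal))

      all-zero : ¬ (q ≈ t) → (∀ {w a} → par t w ≡ just (v , a) → ¬ (q ≈ flipTo t w β)) →
        [ q ≈? t ] + ∑ n flips * inv k ≡ 0ℚ
      all-zero ¬e ¬f = trans (cong₂ _+_ ([]-false (q ≈? t) ¬e)
        (trans (cong (_* inv k) flips-zero) (*-zeroˡ (inv k)))) (+-identityˡ 0ℚ)
        where
        flips-zero : ∑ n flips ≡ 0ℚ
        flips-zero = ∑-zero n flips (λ w → if-zero (isPar t w v) (λ p →
          []-false (q ≈? flipTo t w β) (¬f (proj₂ (reflects-to (isPar-reflects t w v) p)))))

      at-β : (if not (used q u β) then rec β (childWithColor q v β) else 0ℚ) ≡ [ q ≈? t ] + ∑ n flips * inv k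
      at-β with used q u β in used-β
      ... | true = sym (all-zero
        (λ e → free-u (Used-resp e β-used))
        (λ pw e → free-u (proj₂ (flipTo-Used-u Ct pw free-v) (Used-resp e β-used))))
        where
        β-used : Used q u β
        β-used = reflects-to (used-reflects q u β) used-β
      ... | false with childWithColor q v β in cwc
      ...   | nothing = begin
        [ attach q β ≈? t′ ]               ≡⟨ attach-iff (shp C) ⟩
        [ q ≈? t ]                         ≡⟨ sym (+-identityʳ [ q ≈? t ]) ⟩
        [ q ≈? t ] + 0ℚ                   ≡⟨ cong ([ q ≈? t ] +_) (sym (*-zeroˡ (inv k))) ⟩
        [ q ≈? t ] + 0ℚ * inv k          ≡⟨ cong (λ z → [ q ≈? t ] + z * inv k) (sym flips-zero) ⟩
        [ q ≈? t ] + ∑ n flips * inv k   ∎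
        where
        open ≡-Reasoning
        flips-zero : ∑ n flips ≡ 0ℚ
        flips-zero = ∑-zero n flips (λ w → if-zero (isPar t w v) (λ p →
          []-false (q ≈? flipTo t w β) (λ e → childWithColor-nothing {q} cwc w
            (trans (at e w) (flipTo-colour Ct (proj₂ (reflects-to (isPar-reflects t w v) p)) free-v)))))
      ...   | just w with shape⇒par (shp Ct) (par⇒shape (shp C) (childWithColor-just {q} cwc))
      ...     | α , tw = begin
        ∑ κ choices * inv k              ≡⟨ cong (_* inv k) (∑-single κ choices α other-α) ⟩
        choices α * inv k                ≡⟨ cong (_* inv k) at-α ⟩
        [ q ≈? flipTo t w β ] * inv k    ≡⟨ cong (_* inv k) (sym at-w) ⟩
        ∑ n flips * inv k                ≡⟨ sym (+-identityˡ (∑ n flips * inv k)) ⟩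
        0ℚ + ∑ n flips * inv k          ≡⟨ cong (_+ ∑ n flips * inv k) (sym ([]-false (q ≈? t) q≉t)) ⟩
        [ q ≈? t ] + ∑ n flips * inv k  ∎
        where
        open ≡-Reasoning
        qw : par q w ≡ just (v , β)
        qw = childWithColor-just {q} cwc
        q≉t : ¬ (q ≈ t)
        q≉t e = free-v (w , downward (trans (sym (at e w)) qw))
        choices : Fin κ → ℚ
        choices α = if not (used q v α) then [ attach (flipTo q w α) β ≈? t′ ] else 0ℚ
        is-free : ∀ {α} → not (used q v α) ≡ true → ¬ Used q v α
        is-free {α} = reflects-to (available-reflects q v α)
        to-t : ∀ {α} → ¬ Used q v α → attach (flipTo q w α) β ≈ t′ → flipTo q w α ≈ t
        to-t ¬α e = attach-injective (shp (flipTo-coloured C qw ¬α)) (shp Ct) (≈-trans e equal)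
        other-α : ∀ α′ → α′ ≢ α → choices α′ ≡ 0ℚ
        other-α α′ ne = if-zero (not (used q v α′)) λ free → []-false (attach (flipTo q w α′) β ≈? t′) λ e →
          ne (cong proj₂ (Maybe.just-injective (trans (sym (flipTo-colour C qw (is-free free)))
            (trans (at (to-t (is-free free) e) w) tw))))
        at-α : choices α ≡ [ q ≈? flipTo t w β ]
        at-α with used q v α in used-α
        ... | true = sym ([]-false (q ≈? flipTo t w β) λ e →
          flipTo-frees Ct tw free-v (Used-resp e (reflects-to (used-reflects q v α) used-α)))
        ... | false = []-cong (attach (flipTo q w α) β ≈? t′) (q ≈? flipTo t w β)
          (λ e → flipTo-inverse C qw ¬α (to-t ¬α e))
          (λ e → ≈-trans (attach-cong (≈-sym (flipTo-inverse Ct tw free-v (≈-sym e)))) (≈-sym equal))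
          where
          ¬α : ¬ Used q v α
          ¬α = reflects-¬ (used-reflects q v α) used-α
        at-w : ∑ n flips ≡ [ q ≈? flipTo t w β ]
        at-w = trans (∑-single n flips w λ w′ ne → if-zero (isPar t w′ v) λ p →
            []-false (q ≈? flipTo t w′ β) λ e → ne (unique (prop C)
              (downward (trans (at e w′) (flipTo-colour Ct (proj₂ (reflects-to (isPar-reflects t w′ v) p)) free-v)))
              (downward qw)))
          (cong (λ b → if b then [ q ≈? flipTo t w β ] else 0ℚ) (reflects-from (isPar-reflects t w v) (α , tw)))

    insert-probability : ∀ {s} → Prepared s q →
      Ex (insertNamed s u v) (λ s′ → [ s′ ≈? t′ ]) ≡
      ([ q ≈? t ] + ∑ n (λ w → if isPar t w v then [ q ≈? flipTo t w β ] else 0ℚ) * inv (length (avail q v)))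
        * inv (length (avail q u))
    insert-probability {s} P = trans (Ex-insertNamed is-t′ is-t′-resp C P)
      (cong (_* inv (length (avail q u)))
        (trans (∑-single κ _ β (λ β′ ne → if-zero (not (used q u β′)) (λ _ → rec-zero β′ (childWithColor q v β′) ne))) at-β))

  module _ {s q : St n κ} (C : Coloured q) (P : Prepared s q)
           (k≢0 : ℕ.NonZero (length (avail q u))) (l≢0 : ℕ.NonZero (length (avail q v))) where

    open Prepared P

    insert-always : Always (λ t′ → r⁺ ⊢ t′ × Proper t′) (insertNamed s u v)
    insert-always = subst (λ xs → ℕ.NonZero (length xs)) (sym avail-u) k≢0 , inner
      where
      good : ∀ {s₁ q′ β} → Coloured q′ → s₁ ≈ attach q′ β → ¬ Used q′ u β → ¬ Used q′ v β → r⁺ ⊢ s₁ × Proper s₁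
      good C′ s₁≈ ¬u ¬v =
        ⊢-resp (≈-sym s₁≈) (attach-⊢ (shp C′)) , Proper-resp (≈-sym s₁≈) (attach-proper (prop C′) ¬u ¬v)
      free-u : ∀ i → ¬ Used q u (lookup (avail s u) i)
      free-u rewrite avail-u = λ i →
        reflects-to (available-reflects q u _) (lookup-filter (λ a → not (used q u a)) (λ a → a) i)
      inner : ∀ i → Always (λ t′ → r⁺ ⊢ t′ × Proper t′) (body (insertNamed s u v) i)
      inner i rewrite childWithColor-attach C (attaches (lookup (avail s u) i))
        with childWithColor q v (lookup (avail s u) i) in eq
      ... | nothing = good C (attaches (lookup (avail s u) i)) (free-u i) (¬Used-v {q} C eq)
      ... | just w = subst (λ xs → ℕ.NonZero (length xs)) (sym avail≡) l≢0 , λ j → recoloured (is-free j)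
        where
        β : Fin κ
        β = lookup (avail s u) i
        s₁ : St n κ
        s₁ = rerootAttach (suc n) s v (just (u , β))
        qw : par q w ≡ just (v , β)
        qw = childWithColor-just {q} eq
        avail≡ : avail s₁ v ≡ avail q v
        avail≡ = avail-attach C (attaches β) (w , downward qw)
        is-free : ∀ j → ¬ Used q v (lookup (avail s₁ v) j)
        is-free rewrite avail≡ = λ j →
          reflects-to (available-reflects q v _) (lookup-filter (λ a → not (used q v a)) (λ a → a) j)
        recoloured : ∀ {α} → ¬ Used q v α →
          let t′ = fixForbidden (suc n) (recolor s₁ w α) w β α in r⁺ ⊢ t′ × Proper t′
        recoloured ¬α = good (flipTo-coloured C qw ¬α)
          (fixForbidden-attach C (attaches β) qw (λ { refl → ¬α (w , downward qw) }))
          (λ used → free-u i (proj₂ (flipTo-Used-u C qw ¬α) used))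
          (flipTo-frees C qw ¬α)

  module _ {s′ : St n κ} (A : Attached s′) where

    open Attached A renaming (base to q; colour to α; base-coloured to C)

    private
      outcome : Maybe (Fin n) → St n κ
      outcome nothing  = detach s′
      outcome (just w) = flipTo (detach s′) w α

      size-delete : size (deleteChild s′ v) ≡ κ
      size-delete with par s′ v | parent
      ... | just _ | refl = refl

      body-delete : ∀ i → body (deleteChild s′ v) i ≡ ret (outcome (nth (children (detach s′) v) (toℕ i)))
      body-delete i with par s′ v | parent
      body-delete i | just _ | refl with nth (children (detach s′) v) (toℕ i)
      ... | nothing = refl
      ... | just w with colOf (detach s′) w
      ...   | just _  = refl
      ...   | nothing = refl

      κ≢0 : ∀ {k} → Fin k → ℕ.NonZero k
      κ≢0 {suc k} _ = _

    delete-always : Always Coloured (deleteChild s′ v)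
    delete-always = Always-body (deleteChild s′ v) (subst ℕ.NonZero (sym size-delete) (κ≢0 α))
      (λ i → subst (Always Coloured) (sym (body-delete i)) (good i))
      where
      good : ∀ (i : Fin (size (deleteChild s′ v))) → Coloured (outcome (nth (children (detach s′) v) (toℕ i)))
      good i with nth (children (detach s′) v) (toℕ i) in e
      ... | nothing = C
      ... | just w  = flipTo-coloured C
        (proj₂ (reflects-to (isPar-reflects (detach s′) w v) (nth-filter {n = n} {κ} {Δ} _ (λ x → x) (toℕ i) e)))
        free-v

    delete-probability : ∀ l → l ℕ.+ length (children q v) ≡ κ → ∀ t →
      Ex (deleteChild s′ v) (λ s → [ s ≈? t ]) ≡
      (∑ n (λ w → if isPar q w v then [ flipTo q w α ≈? t ] else 0ℚ) + ι l * [ q ≈? t ]) * inv κ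
    delete-probability l l+k t = begin
      Ex (deleteChild s′ v) is-t
        ≡⟨ Ex-body (deleteChild s′ v) is-t (subst ℕ.NonZero (sym size-delete) (κ≢0 α)) ⟩
      ∑ (size (deleteChild s′ v)) (λ i → Ex (body (deleteChild s′ v) i) is-t) * inv (size (deleteChild s′ v))
        ≡⟨ cong (_* inv (size (deleteChild s′ v))) (∑-cong _ (λ i → cong (λ m → Ex m is-t) (body-delete i))) ⟩
      ∑ (size (deleteChild s′ v)) (λ i → h (nth xs (toℕ i))) * inv (size (deleteChild s′ v))
        ≡⟨ cong (λ k → ∑ k (λ i → h (nth xs (toℕ i))) * inv k) size-delete ⟩
      ∑ κ (λ i → h (nth xs (toℕ i))) * inv κ
        ≡⟨ cong (_* inv κ) (∑-nth {n = n} {κ} {Δ} κ xs l l+k h) ⟩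
      (∑ (length xs) (λ j → h (just (lookup xs j))) + ι l * h nothing) * inv κ
        ≡⟨ cong (λ z → (z + ι l * h nothing) * inv κ) (∑-filter n (λ x → isPar (detach s′) x v) (λ w → h (just w))) ⟩
      (∑ n (λ w → if isPar (detach s′) w v then h (just w) else 0ℚ) + ι l * h nothing) * inv κ ∎
      where
      open ≡-Reasoning
      xs : List (Fin n)
      xs = children (detach s′) v
      is-t : St n κ → ℚ
      is-t s = [ s ≈? t ]
      h : Maybe (Fin n) → ℚ
      h mw = is-t (outcome mw)

data Adjacent {n : ℕ} (r : Shape n) (x y : Fin n) : Set where
  upward   : r x ≡ just y → Adjacent r x y
  downward : r y ≡ just x → Adjacent r x y

module Uniformity {n κ : ℕ} where

  open States {n} {κ}

  Adjacent⇒Edge : ∀ {r s x y} → r ⊢ s → Adjacent r x y → ∃ (Edge s x y)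
  Adjacent⇒Edge r⊢s (upward e)   = _ , upward (proj₂ (shape⇒par r⊢s e))
  Adjacent⇒Edge r⊢s (downward e) = _ , downward (proj₂ (shape⇒par r⊢s e))

  Edge⇒Adjacent : ∀ {r s x y a} → r ⊢ s → Edge s x y a → Adjacent r x y
  Edge⇒Adjacent r⊢s (upward e)   = upward (par⇒shape r⊢s e)
  Edge⇒Adjacent r⊢s (downward e) = downward (par⇒shape r⊢s e)

  record Invariant (G : Adj n) (r : Shape n) (m : Rand (St n κ)) : Set where
    field
      acyclic   : Acyclic r
      adjacency : ∀ x y → Reflects (Adjacent r x y) (G x y)
      support   : Always (λ s → r ⊢ s × Proper s) m
      uniform   : ∀ {t₁ t₂} → r ⊢ t₁ → Proper t₁ → r ⊢ t₂ → Proper t₂ →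
        Ex m (λ s → [ s ≈? t₁ ]) ≡ Ex m (λ s → [ s ≈? t₂ ])

  Invariant-≋ : ∀ {G r m m′} → m ≋ m′ → Invariant G r m → Invariant G r m′
  Invariant-≋ m≋m′ I = record
    { acyclic = acyclic ; adjacency = adjacency ; support = ≋-Always m≋m′ support
    ; uniform = λ r⊢t₁ p₁ r⊢t₂ p₂ →
        trans (sym (≋-Ex m≋m′ _)) (trans (uniform r⊢t₁ p₁ r⊢t₂ p₂) (≋-Ex m≋m′ _)) }
    where open Invariant I

  Invariant-resp : ∀ {G G′ r m} → (∀ x y → G x y ≡ G′ x y) → Invariant G r m → Invariant G′ r m
  Invariant-resp G≡G′ I = record
    { acyclic = acyclic ; adjacency = λ x y → subst (Reflects _) (G≡G′ x y) (adjacency x y)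
    ; support = support ; uniform = uniform }
    where open Invariant I

module Invariants {n κ Δ : ℕ} where

  open Operations {n} {κ} {Δ} public
  open Reroot {n} {κ} {Δ} public
  open Uniformity {n} {κ} public

  length-avail-deg : ∀ {G r s} → Acyclic r → (∀ x y → Reflects (Adjacent r x y) (G x y)) → r ⊢ s → Proper s →
    ∀ x → length (avail s x) ℕ.+ degF G x ≡ κ
  length-avail-deg {G} {r} {s} ac adj r⊢s pr x =
    trans (cong (λ xs → length (avail s x) ℕ.+ length xs) (filter-cong λ y →
             reflects-≡ (adj x y) (stateAdj-reflects s x y) (Adjacent⇒Edge r⊢s) (λ (_ , e) → Edge⇒Adjacent r⊢s e)))
          (length-avail ac r⊢s pr x)

  reconstructPar : (Fin n → Maybe (Fin κ)) → Maybe (Fin n) → Maybe (Fin n × Fin κ)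
  reconstructPar c nothing  = nothing
  reconstructPar c (just p) = Maybe.map (p ,_) (c p)

  reconstruct : Shape n → (Fin n → Fin n → Maybe (Fin κ)) → St n κ
  reconstruct r C = record { par = λ x → reconstructPar (C x) (r x) }

  module _ (r : Shape n) (C : Fin n → Fin n → Maybe (Fin κ)) where

    reconstruct-par : ∀ {x y a} → r x ≡ just y → C x y ≡ just a → par (reconstruct r C) x ≡ just (y , a)
    reconstruct-par {x} {y} e e′ rewrite e | e′ = refl

    par-reconstruct : ∀ {x y a} → par (reconstruct r C) x ≡ just (y , a) → r x ≡ just y × C x y ≡ just a
    par-reconstruct {x} e with r x
    par-reconstruct {x} e | just p with C x p in e′
    par-reconstruct {x} refl | just p | just a = refl , e′

    reconstruct-⊢ : (∀ {x p} → r x ≡ just p → ∃ λ a → C x p ≡ just a) → r ⊢ reconstruct r C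
    reconstruct-⊢ total = shaped go
      where
      go : ∀ x → shape (reconstruct r C) x ≡ r x
      go x with r x in e
      ... | nothing = refl
      ... | just p with total e
      ...   | a , e′ rewrite e′ = refl

  module _ {r r′ : Shape n} (adj-to : ∀ {x y} → Adjacent r x y → Adjacent r′ x y)
           (adj-from : ∀ {x y} → Adjacent r′ x y → Adjacent r x y)
           (ac′ : Acyclic r′) {t : St n κ} (r′⊢t : r′ ⊢ t) where

    transfer-⊢ : r ⊢ reconstruct r (stateCol t)
    transfer-⊢ = reconstruct-⊢ r (stateCol t) λ e → let (a , e′) = Adjacent⇒Edge r′⊢t (adj-to (upward e)) in a , stateCol-edge ac′ r′⊢t e′

    transfer-edges : SameEdges t (reconstruct r (stateCol t))
    transfer-edges = record
      { edge-to = λ e → to (adj-from (Edge⇒Adjacent r′⊢t e)) e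
      ; edge-from = λ { (upward e) → from e ; (downward e) → Edge-sym (from e) } }
      where
      to : ∀ {x y a} → Adjacent r x y → Edge t x y a → Edge (reconstruct r (stateCol t)) x y a
      to (upward rx)   e = upward (reconstruct-par r (stateCol t) rx (stateCol-edge ac′ r′⊢t e))
      to (downward ry) e = downward (reconstruct-par r (stateCol t) ry (stateCol-edge ac′ r′⊢t (Edge-sym e)))
      from : ∀ {x y a} → par (reconstruct r (stateCol t)) x ≡ just (y , a) → Edge t x y a
      from e = edge-stateCol ac′ r′⊢t (proj₂ (par-reconstruct r (stateCol t) e))

  reroot : Fin n → St n κ → St n κ
  reroot v s = rerootAttach (suc n) s v nothing

  module _ {G r m} (I : Invariant G r m) (v : Fin n) where

    open Invariant I
    open Rerooted

    private
      s₀ : St n κ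
      s₀ = proj₁ (witness m support)
      r⊢s₀ : r ⊢ s₀
      r⊢s₀ = proj₁ (proj₂ (witness m support))

    rerootedShape : Shape n
    rerootedShape = shape (reroot v s₀)

    rerooted : ∀ {s} → r ⊢ s → Rerooted acyclic v nothing s (reroot v s)
    rerooted r⊢s = rerootAttach-Rerooted acyclic r⊢s

    reroot-⊢ : ∀ {s} → r ⊢ s → rerootedShape ⊢ reroot v s
    reroot-⊢ r⊢s = Rerooted-⊢ acyclic r⊢s₀ r⊢s (rerooted r⊢s₀) (rerooted r⊢s)

    reroot-edges : ∀ {s} → r ⊢ s → SameEdges s (reroot v s)
    reroot-edges r⊢s = Rerooted-SameEdges acyclic r⊢s (rerooted r⊢s)

    rerootedShape-root : rerootedShape v ≡ nothing
    rerootedShape-root = cong (Maybe.map proj₁) (start (rerooted r⊢s₀))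

    reroot-Invariant : Invariant G rerootedShape (m >>= λ s → ret (reroot v s))
    reroot-Invariant = record
      { acyclic   = ac′
      ; adjacency = λ x y → reflects-map adj-to adj-from (adjacency x y)
      ; support   = Always->>= m _ support λ (r⊢s , pr) → reroot-⊢ r⊢s , SameEdges⇒Proper (reroot-edges r⊢s) pr
      ; uniform   = λ {t₁} {t₂} r′⊢t₁ pr₁ r′⊢t₂ pr₂ → trans (pull r′⊢t₁)
          (trans (uniform (transfer-⊢ adj-to adj-from ac′ r′⊢t₁) (SameEdges⇒Proper (transfer-edges adj-to adj-from ac′ r′⊢t₁) pr₁)
                          (transfer-⊢ adj-to adj-from ac′ r′⊢t₂) (SameEdges⇒Proper (transfer-edges adj-to adj-from ac′ r′⊢t₂) pr₂))
                 (sym (pull r′⊢t₂))) }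
      where
      r′ : Shape n
      r′ = rerootedShape
      ac′ : Acyclic r′
      ac′ = Rerooted-Acyclic acyclic r⊢s₀ (rerooted r⊢s₀)
      adj-to : ∀ {x y} → Adjacent r x y → Adjacent r′ x y
      adj-to a = Edge⇒Adjacent (reroot-⊢ r⊢s₀) (edge-to (reroot-edges r⊢s₀) (proj₂ (Adjacent⇒Edge r⊢s₀ a)))
      adj-from : ∀ {x y} → Adjacent r′ x y → Adjacent r x y
      adj-from a = Edge⇒Adjacent r⊢s₀ (edge-from (reroot-edges r⊢s₀) (proj₂ (Adjacent⇒Edge (reroot-⊢ r⊢s₀) a)))
      pull : ∀ {t} → r′ ⊢ t →
        Ex (m >>= λ s → ret (reroot v s)) (λ s → [ s ≈? t ]) ≡ Ex m (λ s → [ s ≈? reconstruct r (stateCol t) ])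
      pull {t} r′⊢t = trans (Ex->>= m _ _) (Ex-cong m support λ s (r⊢s , _) →
        []-cong (reroot v s ≈? t) (s ≈? reconstruct r (stateCol t))
          (λ e → SameEdges⇒≈ acyclic r⊢s (transfer-⊢ adj-to adj-from ac′ r′⊢t)
            (SameEdges-trans (reroot-edges r⊢s) (SameEdges-trans (≈⇒SameEdges e) (transfer-edges adj-to adj-from ac′ r′⊢t))))
          (λ e → SameEdges⇒≈ ac′ (reroot-⊢ r⊢s) r′⊢t
            (SameEdges-trans (SameEdges-sym (reroot-edges r⊢s))
              (SameEdges-trans (≈⇒SameEdges e) (SameEdges-sym (transfer-edges adj-to adj-from ac′ r′⊢t))))))

Endpoints : {n : ℕ} → Fin n → Fin n → Fin n → Fin n → Set
Endpoints u v x y = (x ≡ u × y ≡ v) ⊎ (x ≡ v × y ≡ u)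

module _ {n : ℕ} (G : Adj n) (u v x y : Fin n) {P : Set} (rP : Reflects P (G x y)) where

  private
    endpoints : Reflects (Endpoints u v x y) ((x == u ∧ y == v) ∨ (x == v ∧ y == u))
    endpoints = (==-reflects x u ×-reflects ==-reflects y v) ⊎-reflects (==-reflects x v ×-reflects ==-reflects y u)

  setEdge-true : Reflects (Endpoints u v x y ⊎ P) (setEdge G u v true x y)
  setEdge-true with (x == u ∧ y == v) ∨ (x == v ∧ y == u) | endpoints
  ... | true  | ofʸ e  = ofʸ (inj₁ e)
  ... | false | ofⁿ ¬e = reflects-map inj₂ [ (λ e → ⊥-elim (¬e e)) , (λ p → p) ]′ rP

  setEdge-false : Reflects (¬ Endpoints u v x y × P) (setEdge G u v false x y)
  setEdge-false with (x == u ∧ y == v) ∨ (x == v ∧ y == u) | endpoints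
  ... | true  | ofʸ e  = ofⁿ λ (¬e , _) → ¬e e
  ... | false | ofⁿ ¬e = reflects-map (¬e ,_) proj₂ rP

setEdge-sym : ∀ {n} (G : Adj n) u v b x y → setEdge G u v b x y ≡ setEdge G v u b x y
setEdge-sym G u v b x y = cong (λ c → if c then b else G x y) (∨-comm (x == u ∧ y == v) (x == v ∧ y == u))

sum-≢0 : ∀ {k l m} → k ℕ.+ l ≡ m → l ℕ.< m → ℕ.NonZero k
sum-≢0 {zero}  refl l<l = ⊥-elim (ℕ.<-irrefl refl l<l)
sum-≢0 {suc k} _    _   = _

module Insertion {n κ Δ : ℕ} where

  open Invariants {n} {κ} {Δ}

  module _ {G r m} (I : Invariant G r m) {u v : Fin n} (¬conn : ¬ Conn G u v)
           (u<κ : degF G u ℕ.< κ) (v<κ : degF G v ℕ.< κ) where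

    private
      open Invariant I using (support) renaming (acyclic to ac-r)
      IR : Invariant G (rerootedShape I v) (m >>= λ s → ret (reroot v s))
      IR = reroot-Invariant I v
      open Invariant IR using (acyclic; adjacency; uniform)

      mR : Rand (St n κ)
      mR = m >>= λ s → ret (reroot v s)

      below⇒conn : ∀ {x} → Below (rerootedShape I v) v x → Conn G x v
      below⇒conn here     = here
      below⇒conn (up e b) = step (reflects-from (adjacency _ _) (upward e)) (below⇒conn b)

      module L = Kernels {n} {κ} {Δ} (rerootedShape I v) acyclic u v (rerootedShape-root I v) (λ b → ¬conn (below⇒conn b))
      open L using (Coloured; coloured; shp; prop; Attached; flipTo; Prepared)

      reroot-coloured : ∀ {s} → r ⊢ s × Proper s → Coloured (reroot v s)
      reroot-coloured (r⊢s , pr) = coloured (reroot-⊢ I v r⊢s) (SameEdges⇒Proper (reroot-edges I v r⊢s) pr)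

      prepared : ∀ {s} → r ⊢ s → Prepared s (reroot v s)
      prepared {s} r⊢s = record
        { avail-u  = avail-cong (λ (y , e) → y , edge-to (reroot-edges I v r⊢s) e)
                                (λ (y , e) → y , edge-from (reroot-edges I v r⊢s) e)
        ; attaches = λ β → Rerooted-attach ac-r r⊢s (rerooted I v r⊢s) (rerootAttach-Rerooted ac-r r⊢s) }

      avail-deg : ∀ {q} → Coloured q → ∀ x → length (avail q x) ℕ.+ degF G x ≡ κ
      avail-deg C = length-avail-deg acyclic adjacency (shp C) (prop C)

      free : Fin n → ℕ
      free x = κ ℕ.∸ degF G x

      avail-free : ∀ {q} → Coloured q → ∀ x → length (avail q x) ≡ free x
      avail-free {q} C x = sym (trans (cong (ℕ._∸ degF G x) (sym (avail-deg C x))) (ℕ.m+n∸n≡m (length (avail q x)) (degF G x)))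

      module _ {t′} (A : Attached t′) where
        open Attached A renaming (base to t; colour to β; base-coloured to Ct)

        flips : Fin n → St n κ → ℚ
        flips w q = if isPar t w v then [ q ≈? flipTo t w β ] else 0ℚ

        Ex-insert : Ex (m >>= λ s → insertNamed s u v) (λ s → [ s ≈? t′ ]) ≡
          (Ex mR (λ q → [ q ≈? t ]) + ∑ n (λ w → Ex mR (flips w)) * inv (free v)) * inv (free u)
        Ex-insert = begin
          Ex (m >>= λ s → insertNamed s u v) (λ s → [ s ≈? t′ ])
            ≡⟨ Ex->>= m _ _ ⟩
          Ex m (λ s → Ex (insertNamed s u v) (λ s → [ s ≈? t′ ]))
            ≡⟨ Ex-cong m support (λ s Qs → trans (L.insert-probability (reroot-coloured Qs) A (prepared (proj₁ Qs)))
                 (cong₂ (λ k l → ([ reroot v s ≈? t ] + ∑ n (λ w → flips w (reroot v s)) * inv k) * inv l)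
                   (avail-free (reroot-coloured Qs) v) (avail-free (reroot-coloured Qs) u))) ⟩
          Ex m (λ s → ([ reroot v s ≈? t ] + ∑ n (λ w → flips w (reroot v s)) * inv (free v)) * inv (free u))
            ≡⟨ sym (Ex->>= m (λ s → ret (reroot v s)) (λ q → ([ q ≈? t ] + ∑ n (λ w → flips w q) * inv (free v)) * inv (free u))) ⟩
          Ex mR (λ q → ([ q ≈? t ] + ∑ n (λ w → flips w q) * inv (free v)) * inv (free u))
            ≡⟨ Ex-*ʳ mR _ (inv (free u)) ⟩
          Ex mR (λ q → [ q ≈? t ] + ∑ n (λ w → flips w q) * inv (free v)) * inv (free u)
            ≡⟨ cong (_* inv (free u)) (trans (Ex-+ mR _ _) (cong (Ex mR (λ q → [ q ≈? t ]) +_)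
                 (trans (Ex-*ʳ mR _ (inv (free v))) (cong (_* inv (free v)) (Ex-∑ n mR flips))))) ⟩
          (Ex mR (λ q → [ q ≈? t ]) + ∑ n (λ w → Ex mR (flips w)) * inv (free v)) * inv (free u) ∎
          where open ≡-Reasoning

      uniform-R : ∀ {t₁ t₂} → Coloured t₁ → Coloured t₂ → Ex mR (λ q → [ q ≈? t₁ ]) ≡ Ex mR (λ q → [ q ≈? t₂ ])
      uniform-R C₁ C₂ = uniform (shp C₁) (prop C₁) (shp C₂) (prop C₂)

      flips-uniform : ∀ {t₁ t₂} (A₁ : Attached t₁) (A₂ : Attached t₂) w → Ex mR (flips A₁ w) ≡ Ex mR (flips A₂ w)
      flips-uniform A₁ A₂ w
        with isPar (Attached.base A₁) w v | isPar (Attached.base A₂) w v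
           | isPar-reflects (Attached.base A₁) w v | isPar-reflects (Attached.base A₂) w v
      ... | true  | true  | ofʸ (_ , e₁) | ofʸ (_ , e₂) = uniform-R
        (L.flipTo-coloured (Attached.base-coloured A₁) e₁ (Attached.free-v A₁))
        (L.flipTo-coloured (Attached.base-coloured A₂) e₂ (Attached.free-v A₂))
      ... | false | false | _ | _ = refl
      ... | true  | false | ofʸ (_ , e₁) | ofⁿ ¬e₂ = ⊥-elim (¬e₂ (shape⇒par (shp (Attached.base-coloured A₂))
                                                       (par⇒shape (shp (Attached.base-coloured A₁)) e₁)))
      ... | false | true  | ofⁿ ¬e₁ | ofʸ (_ , e₂) = ⊥-elim (¬e₁ (shape⇒par (shp (Attached.base-coloured A₁))
                                                       (par⇒shape (shp (Attached.base-coloured A₂)) e₂)))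

    insert-Invariant : ∃ λ r′ → Invariant (setEdge G u v true) r′ (m >>= λ s → insertNamed s u v)
    insert-Invariant = L.r⁺ , record
      { acyclic   = L.ac⁺
      ; adjacency = λ x y → reflects-map adj-to adj-from (setEdge-true G u v x y (adjacency x y))
      ; support   = Always->>= m _ support λ Qs → let C = reroot-coloured Qs in
          L.insert-always C (prepared (proj₁ Qs)) (sum-≢0 (avail-deg C u) u<κ) (sum-≢0 (avail-deg C v) v<κ)
      ; uniform   = λ r⊢t₁ p₁ r⊢t₂ p₂ → let A₁ = L.attached r⊢t₁ p₁ ; A₂ = L.attached r⊢t₂ p₂ in
          trans (Ex-insert A₁) (trans
            (cong₂ (λ p q → (p + q * inv (free v)) * inv (free u))
              (uniform-R (Attached.base-coloured A₁) (Attached.base-coloured A₂))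
              (∑-cong n (flips-uniform A₁ A₂)))
            (sym (Ex-insert A₂))) }
      where
      adj-to : ∀ {x y} → Endpoints u v x y ⊎ Adjacent (rerootedShape I v) x y → Adjacent L.r⁺ x y
      adj-to (inj₁ (inj₁ (refl , refl))) = downward L.r⁺-v
      adj-to (inj₁ (inj₂ (refl , refl))) = upward L.r⁺-v
      adj-to (inj₂ (upward e)) = upward (trans (L.r⁺-other λ { refl → just≢nothing (trans (sym e) (rerootedShape-root I v)) }) e)
      adj-to (inj₂ (downward e)) = downward (trans (L.r⁺-other λ { refl → just≢nothing (trans (sym e) (rerootedShape-root I v)) }) e)
      adj-from : ∀ {x y} → Adjacent L.r⁺ x y → Endpoints u v x y ⊎ Adjacent (rerootedShape I v) x y
      adj-from {x} (upward e) with x Fin.≟ v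
      adj-from (upward refl) | yes refl = inj₁ (inj₂ (refl , refl))
      ... | no x≢v = inj₂ (upward e)
      adj-from {y = y} (downward e) with y Fin.≟ v
      adj-from (downward refl) | yes refl = inj₁ (inj₁ (refl , refl))
      ... | no y≢v = inj₂ (downward e)

module Deletion {n κ Δ : ℕ} where

  open Invariants {n} {κ} {Δ}

  length-≢0 : ∀ {k} (p : Fin k → Bool) a → p a ≡ true → ℕ.NonZero (length (filterᵇ p (allFin k)))
  length-≢0 {k} p a pa with filterᵇ p (allFin k) in e
  ... | _ ∷ _ = _
  ... | [] with trans (sym pa) (head-filter-nothing p (λ i → i) (cong head e) a)
  ...   | ()

  module _ {G r m} (I : Invariant G r m) {u v : Fin n} (v↑u : r v ≡ just u) where

    private
      open Invariant I using (support; uniform) renaming (acyclic to ac-r; adjacency to adjacency-r)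

      rq : Shape n
      rq x = if x == v then nothing else r x

      rq-v : rq v ≡ nothing
      rq-v rewrite reflects-from (==-reflects v v) refl = refl

      rq-other : ∀ {x} → x ≢ v → rq x ≡ r x
      rq-other {x} x≢v rewrite reflects-false (==-reflects x v) x≢v = refl

      acyclic : Acyclic rq
      acyclic = Acyclic-detach rq-other ac-r rq-v

      below-r : ∀ {x} → Below rq v x → Below r v x
      below-r here = here
      below-r (up {x} e b) =
        up (trans (sym (rq-other λ { refl → just≢nothing (trans (sym e) rq-v) })) e) (below-r b)

      module L = Kernels {n} {κ} {Δ} rq acyclic u v rq-v (λ b → Ranked.parent-not-below ac-r v↑u (below-r b))
      open L using (Coloured; coloured; shp; prop; Attached; flipTo; Prepared)

      r⁺≡r : ∀ x → L.r⁺ x ≡ r x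
      r⁺≡r x with x Fin.≟ v
      ... | yes refl = sym v↑u
      ... | no _     = refl

      to-r : ∀ {s} → L.r⁺ ⊢ s → r ⊢ s
      to-r r⁺⊢s = shaped λ x → trans (shape-at r⁺⊢s x) (r⁺≡r x)

      attached : ∀ {s} → r ⊢ s × Proper s → Attached s
      attached (r⊢s , pr) = L.attached (shaped λ x → trans (shape-at r⊢s x) (sym (r⁺≡r x))) pr

      G′ : Adj n
      G′ = setEdge G u v false

      adjacency : ∀ x y → Reflects (Adjacent rq x y) (G′ x y)
      adjacency x y = reflects-map adj-to adj-from (setEdge-false G u v x y (adjacency-r x y))
        where
        adj-to : ∀ {x y} → ¬ Endpoints u v x y × Adjacent r x y → Adjacent rq x y
        adj-to (¬e , upward e) = upward (trans (rq-other λ { refl → ¬e (inj₂ (refl , Maybe.just-injective (trans (sym e) v↑u))) }) e)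
        adj-to (¬e , downward e) = downward (trans (rq-other λ { refl → ¬e (inj₁ (Maybe.just-injective (trans (sym e) v↑u) , refl)) }) e)
        old : ∀ {x y} → rq x ≡ just y → x ≢ v × r x ≡ just y
        old e = x≢v , trans (sym (rq-other x≢v)) e
          where
          x≢v : _ ≢ v
          x≢v refl = just≢nothing (trans (sym e) rq-v)
        no-back : ∀ {x y} → x ≡ u → y ≡ v → r x ≢ just y
        no-back refl refl = Ranked.no-2-cycle ac-r v↑u
        adj-from : ∀ {x y} → Adjacent rq x y → ¬ Endpoints u v x y × Adjacent r x y
        adj-from (upward e) with old e
        ... | x≢v , e′ = [ (λ (x≡u , y≡v) → no-back x≡u y≡v e′) , (λ (x≡v , _) → x≢v x≡v) ]′ , upward e′
        adj-from (downward e) with old e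
        ... | y≢v , e′ = [ (λ (_ , y≡v) → y≢v y≡v) , (λ (x≡v , y≡u) → no-back y≡u x≡v e′) ]′ , downward e′

      free : Fin n → ℕ
      free x = κ ℕ.∸ degF G′ x

      avail-deg : ∀ {q} → Coloured q → ∀ x → length (avail q x) ℕ.+ degF G′ x ≡ κ
      avail-deg C = length-avail-deg acyclic adjacency (shp C) (prop C)

      avail-free : ∀ {q} → Coloured q → ∀ x → length (avail q x) ≡ free x
      avail-free {q} C x = sym (trans (cong (ℕ._∸ degF G′ x) (sym (avail-deg C x))) (ℕ.m+n∸n≡m (length (avail q x)) (degF G′ x)))

      children-deg : ∀ {q} → Coloured q → children q v ≡ filterᵇ (G′ v) (allFin n)
      children-deg {q} C = filter-cong λ y → reflects-≡ (isPar-reflects q y v) (adjacency v y)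
        (λ (_ , e) → downward (par⇒shape (shp C) e))
        (λ { (upward e) → ⊥-elim (just≢nothing (trans (sym e) rq-v)) ; (downward e) → shape⇒par (shp C) e })

      prepared : ∀ {t} → Coloured t → Prepared t t
      prepared {t} C = record { avail-u = refl ; attaches = λ β → pointwise λ x → cong (λ s → par s x) (attaches β) }
        where
        attaches : ∀ β → rerootAttach (suc n) t v (just (u , β)) ≡ L.attach t β
        attaches β with par t v | shape⇒root (shp C) rq-v
        ... | nothing | refl = refl

      s₀ : St n κ
      s₀ = proj₁ (witness m support)
      A₀ : Attached s₀
      A₀ = attached (proj₂ (witness m support))

      free-≢0 : ∀ {q a} x → Coloured q → ¬ Used q x a → ℕ.NonZero (free x)
      free-≢0 {q} {a} x C ¬a = subst ℕ.NonZero (avail-free C x)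
        (length-≢0 (λ b → not (used q x b)) a (reflects-from (available-reflects q x a) ¬a))

      free-u≢0 : ℕ.NonZero (free u)
      free-u≢0 = free-≢0 u (Attached.base-coloured A₀) (Attached.free-u A₀)
      free-v≢0 : ℕ.NonZero (free v)
      free-v≢0 = free-≢0 v (Attached.base-coloured A₀) (Attached.free-v A₀)

      ratio : ℚ
      ratio = ι (free v) * ι (free u) * inv κ

      reversal : ∀ {s′ t} → Attached s′ → Coloured t →
        Ex (deleteChild s′ v) (λ s → [ s ≈? t ]) ≡ Ex (insertNamed t u v) (λ s → [ s ≈? s′ ]) * ratio
      reversal {s′} {t} A Ct = begin
        Ex (deleteChild s′ v) (λ s → [ s ≈? t ])
          ≡⟨ L.delete-probability A (free v) l+k t ⟩
        (∑ n (λ w → if isPar q w v then [ flipTo q w α ≈? t ] else 0ℚ) + ι (free v) * [ q ≈? t ]) * inv κ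
          ≡⟨ cong₂ (λ x y → (x + ι (free v) * y) * inv κ)
               (∑-cong n λ w → cong (λ z → if isPar q w v then z else 0ℚ) (≈?-sym (flipTo q w α) t)) (≈?-sym q t) ⟩
        (S + ι (free v) * p) * inv κ
          ≡⟨ arithmetic p S (inv (free v)) (ι (free v)) (inv (free u)) (ι (free u)) (inv κ)
               (ι*inv (free v) {{free-v≢0}}) (ι*inv (free u) {{free-u≢0}}) ⟩
        (p + S * inv (free v)) * inv (free u) * ratio
          ≡⟨ cong (_* ratio) (sym (cong₂ (λ k l → (p + S * inv k) * inv l) (avail-free Ct v) (avail-free Ct u))) ⟩
        (p + S * inv (length (avail t v))) * inv (length (avail t u)) * ratio
          ≡⟨ cong (_* ratio) (sym (L.insert-probability Ct A (prepared Ct))) ⟩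
        Ex (insertNamed t u v) (λ s → [ s ≈? s′ ]) * ratio ∎
        where
        open ≡-Reasoning
        open Attached A renaming (base to q; colour to α; base-coloured to C)
        ≈?-sym : ∀ (s t : St n κ) → [ s ≈? t ] ≡ [ t ≈? s ]
        ≈?-sym s t = []-cong (s ≈? t) (t ≈? s) ≈-sym ≈-sym
        p : ℚ
        p = [ t ≈? q ]
        S : ℚ
        S = ∑ n (λ w → if isPar q w v then [ t ≈? flipTo q w α ] else 0ℚ)
        l+k : free v ℕ.+ length (children q v) ≡ κ
        l+k = trans (cong₂ (λ k xs → k ℕ.+ length xs) (sym (avail-free C v)) (children-deg C)) (avail-deg C v)
        arithmetic : ∀ p S i k j l z → k * i ≡ 1ℚ → l * j ≡ 1ℚ →
          (S + k * p) * z ≡ (p + S * i) * j * (k * l * z)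
        arithmetic p S i k j l z ki lj = begin
          (S + k * p) * z
            ≡⟨ solve 4 (λ p S k z → (S :+ k :* p) :* z := (S :* con 1ℚ :+ k :* p) :* con 1ℚ :* z) refl p S k z ⟩
          (S * 1ℚ + k * p) * 1ℚ * z
            ≡⟨ cong₂ (λ x y → (S * x + k * p) * y * z) (sym ki) (sym lj) ⟩
          (S * (k * i) + k * p) * (l * j) * z
            ≡⟨ solve 7 (λ p S i k j l z → (S :* (k :* i) :+ k :* p) :* (l :* j) :* z
                                      := (p :+ S :* i) :* j :* (k :* l :* z)) refl p S i k j l z ⟩
          (p + S * i) * j * (k * l * z) ∎
          where open +-*-Solver

      Ex-delete : ∀ {t} → Coloured t →
        Ex (m >>= λ s → deleteChild s v) (λ s → [ s ≈? t ]) ≡ Ex m (λ s → [ s ≈? s₀ ]) * ratio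
      Ex-delete {t} Ct = begin
        Ex (m >>= λ s → deleteChild s v) (λ s → [ s ≈? t ])
          ≡⟨ Ex->>= m _ _ ⟩
        Ex m (λ s′ → Ex (deleteChild s′ v) (λ s → [ s ≈? t ]))
          ≡⟨ Ex-cong m support (λ s′ Q → reversal (attached Q) Ct) ⟩
        Ex m (λ s′ → Ex (insertNamed t u v) (λ s → [ s ≈? s′ ]) * ratio)
          ≡⟨ Ex-*ʳ m _ ratio ⟩
        Ex m (λ s′ → Ex (insertNamed t u v) (λ s → [ s ≈? s′ ])) * ratio
          ≡⟨ cong (_* ratio) (Ex-swap m (insertNamed t u v) (λ s′ s → [ s ≈? s′ ])) ⟩
        Ex (insertNamed t u v) (λ s → Ex m (λ s′ → [ s ≈? s′ ])) * ratio
          ≡⟨ cong (_* ratio) (Ex-cong (insertNamed t u v) always (λ s (r⁺⊢s , pr) →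
               trans (Ex-≗ m (λ s′ → []-cong (s ≈? s′) (s′ ≈? s) ≈-sym ≈-sym))
                     (uniform (to-r r⁺⊢s) pr (proj₁ Q₀) (proj₂ Q₀)))) ⟩
        Ex (insertNamed t u v) (λ _ → Ex m (λ s → [ s ≈? s₀ ])) * ratio
          ≡⟨ cong (_* ratio) (Ex-const (insertNamed t u v) _ always) ⟩
        Ex m (λ s → [ s ≈? s₀ ]) * ratio ∎
        where
        open ≡-Reasoning
        Q₀ : r ⊢ s₀ × Proper s₀
        Q₀ = proj₂ (witness m support)
        always : Always (λ t′ → L.r⁺ ⊢ t′ × Proper t′) (insertNamed t u v)
        always = L.insert-always Ct (prepared Ct) (subst ℕ.NonZero (sym (avail-free Ct u)) free-u≢0)
                                                  (subst ℕ.NonZero (sym (avail-free Ct v)) free-v≢0)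

    delete-Invariant : ∃ λ r′ → Invariant (setEdge G u v false) r′ (m >>= λ s → deleteChild s v)
    delete-Invariant = rq , record
      { acyclic   = acyclic
      ; adjacency = adjacency
      ; support   = Always->>= m _ support λ {s} Q →
          Always-map (deleteChild s v) (λ C → shp C , prop C) (L.delete-always (attached Q))
      ; uniform   = λ r⊢t₁ p₁ r⊢t₂ p₂ →
          trans (Ex-delete (coloured r⊢t₁ p₁)) (sym (Ex-delete (coloured r⊢t₂ p₂))) }

private
  unfold-foldl : ∀ {n} (go : Adj n → List (Update n) → Adj n) → (∀ G → go G [] ≡ G) →
    (∀ G u us → go G (u ∷ us) ≡ go (applyF G u) us) → ∀ G us → go G us ≡ foldl applyF G us
  unfold-foldl go e e′ G []       = e G
  unfold-foldl go e e′ G (u ∷ us) = trans (e′ G u us) (unfold-foldl go e e′ (applyF G u) us)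

-- The loop inside forestAfter has no name outside its where block, so unification has to supply it:
-- abstracting over its lifted argument turns the constraint on the loop into a pattern.
mutual
  forestLoop : ∀ {n} → List (Update n) → Adj n → List (Update n) → Adj n
  forestLoop = _

  forestAfter≡foldl : ∀ {n} (us : List (Update n)) → forestAfter us ≡ foldl applyF emptyF us
  forestAfter≡foldl []       = refl
  forestAfter≡foldl (u ∷ us) with u ∷ us | applyF emptyF u
  ... | us₀ | G = unfold-foldl (forestLoop us₀) (λ _ → refl) (λ _ _ _ → refl) G us

ValidSeq-take : ∀ {n Δ} {G : Adj n} us t → ValidSeq Δ G us → ValidSeq Δ G (take t us)
ValidSeq-take us       zero    _        = tt'
ValidSeq-take []       (suc t) _        = tt'
ValidSeq-take (u ∷ us) (suc t) (v , vs) = v , ValidSeq-take us t vs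

Conn-sym : ∀ {n} {G : Adj n} → (∀ {x y} → G x y ≡ true → G y x ≡ true) → ∀ {x y} → Conn G x y → Conn G y x
Conn-sym {G = G} G-sym c = go c here
  where
  go : ∀ {x y z} → Conn G x y → Conn G x z → Conn G y z
  go here       c = c
  go (step e d) c = go d (step (G-sym e) c)

module Run {n κ Δ : ℕ} (Δ≤κ : Δ ≤ κ) where

  open Invariants {n} {κ} {Δ}
  open Insertion {n} {κ} {Δ}
  open Deletion {n} {κ} {Δ}

  nameBy : ℕ → ℕ → ℕ → ℕ → Fin n → Fin n → Fin n × Fin n
  nameBy eᵤ eᵥ dᵤ dᵥ u v =
    if (eᵤ ℕ.≤ᵇ Δ) ∧ (eᵥ ℕ.≤ᵇ Δ)
    then (if dᵥ ℕ.≤ᵇ dᵤ then (u , v) else (v , u))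
    else (if eᵥ ℕ.≤ᵇ eᵤ then (u , v) else (v , u))

  module _ {r : Shape n} {s t : St n κ} (r⊢s : r ⊢ s) (r⊢t : r ⊢ t) where

    isPar-shape : ∀ x y → isPar s x y ≡ isPar t x y
    isPar-shape x y = reflects-≡ (isPar-reflects s x y) (isPar-reflects t x y)
      (λ (_ , e) → shape⇒par r⊢t (par⇒shape r⊢s e)) (λ (_ , e) → shape⇒par r⊢s (par⇒shape r⊢t e))

    deg-shape : ∀ x → deg s x ≡ deg t x
    deg-shape x = cong₂ ℕ._+_ (cong length (filter-cong (λ y → isPar-shape y x)))
                              (cong (λ b → if b then 1 else 0) is-just≡)
      where
      is-just≡ : is-just (par s x) ≡ is-just (par t x)
      is-just≡ with par s x | par t x | trans (shape-at r⊢s x) (sym (shape-at r⊢t x))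
      ... | just _  | just _  | _ = refl
      ... | nothing | nothing | _ = refl

    rootF-shape : ∀ f x → rootF f s x ≡ rootF f t x
    rootF-shape zero    x = refl
    rootF-shape (suc f) x with par s x | par t x | trans (shape-at r⊢s x) (sym (shape-at r⊢t x))
    ... | just (p , _) | just (.p , _) | refl = rootF-shape f p
    ... | nothing      | nothing       | _    = refl

    treeEdges-shape : ∀ x → treeEdges s x ≡ treeEdges t x
    treeEdges-shape x = cong (λ xs → length xs ℕ.∸ 1)
      (filter-cong (λ y → cong₂ _==_ (rootF-shape (suc n) y) (rootF-shape (suc n) x)))

    name-shape : ∀ u v → name s u v ≡ name t u v
    name-shape u v = trans
      (cong₂ (λ e f → nameBy e f (deg s u) (deg s v) u v) (treeEdges-shape u) (treeEdges-shape v))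
      (cong₂ (λ d d′ → nameBy (treeEdges t u) (treeEdges t v) d d′ u v) (deg-shape u) (deg-shape v))

  name-cases : ∀ s u v → name s u v ≡ (u , v) ⊎ name s u v ≡ (v , u)
  name-cases s u v = cases ((treeEdges s u ℕ.≤ᵇ Δ) ∧ (treeEdges s v ℕ.≤ᵇ Δ)) (deg s v ℕ.≤ᵇ deg s u) (treeEdges s v ℕ.≤ᵇ treeEdges s u)
    where
    cases : ∀ b c d → let p = if b then (if c then (u , v) else (v , u)) else (if d then (u , v) else (v , u)) in
      p ≡ (u , v) ⊎ p ≡ (v , u)
    cases true  true  _     = inj₁ refl
    cases true  false _     = inj₂ refl
    cases false _     true  = inj₁ refl
    cases false _     false = inj₂ refl

  insert-named : ∀ s u v {u′ v′} → name s u v ≡ (u′ , v′) → insertNamed s u′ v′ ≡ insert s u v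
  insert-named s u v e with name s u v
  insert-named s u v refl | _ = refl

  delete-parent : ∀ {r s u v} → r ⊢ s → r v ≡ just u → deleteChild s v ≡ delete s u v
  delete-parent {r} {s} {u} {v} r⊢s e rewrite reflects-from (isPar-reflects s v u) (shape⇒par r⊢s e) = refl

  delete-child : ∀ {r s u v} → Acyclic r → r ⊢ s → r u ≡ just v → deleteChild s u ≡ delete s u v
  delete-child {r} {s} {u} {v} ac r⊢s e
    rewrite reflects-false (isPar-reflects s v u) (λ (_ , e′) → Ranked.no-2-cycle ac e (par⇒shape r⊢s e′)) = refl

  module _ {G r m} (I : Invariant G r m) where

    open Invariant I

    private
      G-sym : ∀ {x y} → G x y ≡ true → G y x ≡ true
      G-sym {x} {y} e with reflects-to (adjacency x y) e
      ... | upward e′   = reflects-from (adjacency y x) (downward e′)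
      ... | downward e′ = reflects-from (adjacency y x) (upward e′)

      insert-same : ∀ {s₀ u v u′ v′} → r ⊢ s₀ → name s₀ u v ≡ (u′ , v′) →
        (m >>= λ s → insertNamed s u′ v′) ≋ (m >>= λ s → stepU s (ins u v))
      insert-same {u = u} {v} {u′} {v′} r⊢s₀ e = >>=-cong m (λ s → insertNamed s u′ v′) (λ s → insert s u v) support
        λ {s} (r⊢s , _) → insert-named s u v (trans (name-shape r⊢s r⊢s₀ u v) e)

    step-insert : ∀ {s₀} u v → r ⊢ s₀ → name s₀ u v ≡ (u , v) ⊎ name s₀ u v ≡ (v , u) → ValidUpd Δ G (ins u v) →
      ∃ λ r′ → Invariant (applyF G (ins u v)) r′ (m >>= λ s → stepU s (ins u v))
    step-insert u v r⊢s₀ (inj₁ e) (_ , ¬conn , u<Δ , v<Δ) = _ , Invariant-≋ (insert-same r⊢s₀ e)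
      (proj₂ (insert-Invariant I ¬conn (ℕ.<-≤-trans u<Δ Δ≤κ) (ℕ.<-≤-trans v<Δ Δ≤κ)))
    step-insert u v r⊢s₀ (inj₂ e) (_ , ¬conn , u<Δ , v<Δ) = _ , Invariant-resp (setEdge-sym G v u true)
      (Invariant-≋ (insert-same r⊢s₀ e)
        (proj₂ (insert-Invariant I (λ c → ¬conn (Conn-sym G-sym c)) (ℕ.<-≤-trans v<Δ Δ≤κ) (ℕ.<-≤-trans u<Δ Δ≤κ))))

    step-delete : ∀ u v → Adjacent r u v →
      ∃ λ r′ → Invariant (applyF G (del u v)) r′ (m >>= λ s → stepU s (del u v))
    step-delete u v (downward e) = _ , Invariant-≋
      (>>=-cong m (λ s → deleteChild s v) (λ s → delete s u v) support λ (r⊢s , _) → delete-parent r⊢s e)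
      (proj₂ (delete-Invariant I e))
    step-delete u v (upward e) = _ , Invariant-resp (setEdge-sym G v u false) (Invariant-≋
      (>>=-cong m (λ s → deleteChild s u) (λ s → delete s u v) support λ (r⊢s , _) → delete-child acyclic r⊢s e)
      (proj₂ (delete-Invariant I e)))

    step-Invariant : ∀ upd → ValidUpd Δ G upd → ∃ λ r′ → Invariant (applyF G upd) r′ (m >>= λ s → stepU s upd)
    step-Invariant (ins u v) valid =
      let (s₀ , r⊢s₀ , _) = witness m support in step-insert u v r⊢s₀ (name-cases s₀ u v) valid
    step-Invariant (del u v) Guv = step-delete u v (reflects-to (adjacency u v) Guv)

  run-Invariant : ∀ us {G r m} → Invariant G r m → ValidSeq Δ G us →
    ∃ λ r′ → Invariant (foldl applyF G us) r′ (m >>= λ s → run s us)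
  run-Invariant [] {m = m} I _ = _ , Invariant-≋ >>=-ret I
    where
    always : ∀ m {Q : St n κ → Set} → Always Q m → Always Q (m >>= ret)
    always (ret a)      q         = q
    always (choose k h) (k≢0 , q) = k≢0 , λ i → always (h i) (q i)
    >>=-ret : m ≋ (m >>= ret)
    >>=-ret = record { ≋-Ex = λ F → sym (Ex->>= m ret F) ; ≋-Always = always m }
  run-Invariant (u ∷ us) {m = m} I (v , vs) with run-Invariant us (proj₂ (step-Invariant I u v)) vs
  ... | r′ , I′ = r′ , Invariant-≋ (>>=-assoc m (λ s → stepU s u) (λ s → run s us)) I′

  init-Invariant : Invariant emptyF (λ _ → nothing) (ret initSt)
  init-Invariant = record
    { acyclic   = λ x → 0 , isRoot refl
    ; adjacency = λ x y → ofⁿ λ { (upward ()) ; (downward ()) }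
    ; support   = shaped (λ _ → refl) , proper λ { (upward ()) ; (downward ()) }
    ; uniform   = λ {t₁} {t₂} r⊢t₁ _ r⊢t₂ _ → trans ([]-true (initSt ≈? t₁) (is-init r⊢t₁)) (sym ([]-true (initSt ≈? t₂) (is-init r⊢t₂))) }
    where
    is-init : ∀ {t} → (λ _ → nothing) ⊢ t → initSt ≈ t
    is-init r⊢t = pointwise λ x → sym (shape⇒root r⊢t refl)

module Colourings {n κ : ℕ} where

  open Invariants {n} {κ} {0}

  module _ {G : Adj n} {r : Shape n} (ac : Acyclic r) (adj : ∀ x y → Reflects (Adjacent r x y) (G x y)) where

    goodState-true : ∀ {s} → r ⊢ s → Proper s → goodState G s ≡ true
    goodState-true {s} r⊢s pr = cong₂ _∧_
      (allV-true λ x → allV-true λ y → ⇔-true (reflects-≡ (adj x y) (stateAdj-reflects s x y)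
        (Adjacent⇒Edge r⊢s) (λ (_ , e) → Edge⇒Adjacent r⊢s e)))
      (allV-true λ x → allV-true λ y → allV-true λ z → distinct x y z)
      where
      allV-true : {p : Fin n → Bool} → (∀ x → p x ≡ true) → allV p ≡ true
      allV-true {p} h = reflects-from (all-tabulate-reflects p (λ x → x) (λ x → ofTrue (h x))) λ _ → refl
        where
        ofTrue : ∀ {b} → b ≡ true → Reflects (true ≡ true) b
        ofTrue refl = ofʸ refl
      ⇔-true : ∀ {b c} → b ≡ c → (b ⇔ᵇ c) ≡ true
      ⇔-true {true}  refl = refl
      ⇔-true {false} refl = refl
      distinct : ∀ x y z → (not (G x y ∧ G x z ∧ not (y == z)) ∨ not (eqMF (stateCol s x y) (stateCol s x z))) ≡ true
      distinct x y z = reflects-from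
        ((adj x y ×-reflects (adj x z ×-reflects ¬-reflects (==-reflects y z)))
          →-reflects ¬-reflects (eqMF-reflects (stateCol s x y) (stateCol s x z)))
        λ (xy , xz , y≢z) e → let (a , exy) = Adjacent⇒Edge r⊢s xy in
          y≢z (unique pr exy (edge-stateCol ac r⊢s (trans (sym e) (stateCol-edge ac r⊢s exy))))

    module _ {c : Fin n → Fin n → Fin κ} (pc : ProperColoring G c) where

      coloring : St n κ
      coloring = reconstruct r (λ x y → just (c x y))

      coloring-⊢ : r ⊢ coloring
      coloring-⊢ = reconstruct-⊢ r (λ x y → just (c x y)) (λ _ → _ , refl)

      private
        coloring-edge : ∀ {x y a} → Edge coloring x y a → G x y ≡ true × c x y ≡ a
        coloring-edge {x} {y} (upward e) with par-reconstruct r (λ x y → just (c x y)) e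
        ... | rx , refl = reflects-from (adj x y) (upward rx) , refl
        coloring-edge {x} {y} (downward e) with par-reconstruct r (λ x y → just (c x y)) e
        ... | ry , refl = reflects-from (adj x y) (downward ry) , proj₁ pc x y (reflects-from (adj x y) (downward ry))

      coloring-Proper : Proper coloring
      coloring-Proper = proper go
        where
        go : ∀ {x y z a} → Edge coloring x y a → Edge coloring x z a → y ≡ z
        go {x} {y} {z} e e′ with coloring-edge e | coloring-edge e′ | y Fin.≟ z
        ... | _ | _ | yes y≡z = y≡z
        ... | Gxy , refl | Gxz , cxz≡cxy | no y≢z = ⊥-elim (proj₂ pc x y z Gxy Gxz y≢z (sym cxz≡cxy))

      agreesWith-reflects : ∀ {s} → r ⊢ s → Reflects (s ≈ coloring) (agreesWith G c s)
      agreesWith-reflects {s} r⊢s = reflects-map to from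
        (all-tabulate-reflects _ (λ x → x) λ x → all-tabulate-reflects _ (λ y → y) λ y →
          adj x y →-reflects eqMF-reflects (stateCol s x y) (just (c x y)))
        where
        to : (∀ x y → Adjacent r x y → stateCol s x y ≡ just (c x y)) → s ≈ coloring
        to h = pointwise go
          where
          go : ∀ x → par s x ≡ par coloring x
          go x with r x in rx
          ... | nothing = shape⇒root r⊢s rx
          ... | just p with edge-stateCol ac r⊢s (h x p (upward rx))
          ...   | upward e   = e
          ...   | downward e = ⊥-elim (Ranked.no-2-cycle ac rx (par⇒shape r⊢s e))
        from : s ≈ coloring → ∀ x y → Adjacent r x y → stateCol s x y ≡ just (c x y)
        from s≈ x y xy with Adjacent⇒Edge r⊢s xy
        ... | a , e = trans (stateCol-edge ac r⊢s e) (cong just (sym (proj₂ (coloring-edge (Edge-resp s≈ e)))))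

  Pr-agreesWith : ∀ {G : Adj n} {r m} (I : Invariant G r m) {c} (pc : ProperColoring G c) →
    let open Invariant I in
    Pr m (agreesWith G c) ≡ Ex m (λ s → [ s ≈? coloring acyclic adjacency pc ])
  Pr-agreesWith {G} {r} {m} I {c} pc = trans (Pr≡Ex m (agreesWith G c)) (Ex-cong m support λ s (r⊢s , _) →
      cong (λ b → if b then 1ℚ else 0ℚ) (agree s r⊢s))
    where
    open Invariant I
    agree : ∀ s → r ⊢ s → agreesWith G c s ≡ ⌊ s ≈? coloring acyclic adjacency pc ⌋
    agree s r⊢s with s ≈? coloring acyclic adjacency pc
    ... | yes e = reflects-from (agreesWith-reflects acyclic adjacency pc r⊢s) e
    ... | no ¬e = reflects-false (agreesWith-reflects acyclic adjacency pc r⊢s) ¬e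

theorem4p8 : (κ Δ : ℕ) → 2 ≤ Δ → Δ ≤ κ → (n : ℕ) → (us : List (Update n)) →
    ValidSeq Δ emptyF us → (t : ℕ) →
    (Pr (distMaint n κ Δ (take t us)) (goodState (forestAfter (take t us))) ≡ 1ℚ) ×
    ((c₁ c₂ : Fin n → Fin n → Fin κ) →
    ProperColoring (forestAfter (take t us)) c₁ →
    ProperColoring (forestAfter (take t us)) c₂ →
    Pr (distMaint n κ Δ (take t us)) (agreesWith (forestAfter (take t us)) c₁)
    ≡ Pr (distMaint n κ Δ (take t us)) (agreesWith (forestAfter (take t us)) c₂))
theorem4p8 κ Δ _ Δ≤κ n us valid t rewrite forestAfter≡foldl (take t us) =
  Pr-always D (goodState G)
    (Always-map D (λ (r⊢s , pr) → goodState-true acyclic adjacency r⊢s pr) support) ,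
  λ c₁ c₂ pc₁ pc₂ → trans (Pr-agreesWith I pc₁) (trans
    (uniform (coloring-⊢ acyclic adjacency pc₁) (coloring-Proper acyclic adjacency pc₁)
             (coloring-⊢ acyclic adjacency pc₂) (coloring-Proper acyclic adjacency pc₂))
    (sym (Pr-agreesWith I pc₂)))
  where
  open Run {n} {κ} {Δ} Δ≤κ
  open Uniformity {n} {κ}
  open Colourings {n} {κ}
  D : Rand (St n κ)
  D = distMaint n κ Δ (take t us)
  G : Adj n
  G = foldl applyF emptyF (take t us)
  I : Invariant G _ D
  I = proj₂ (run-Invariant (take t us) init-Invariant (ValidSeq-take us t valid))
  open Invariant I
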